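{- Let $\mathfrak A$ be a class of complete types and let $R:\mathfrak A\to \mathrm{Ord}\cup\{\infty\}$ be a rank. Then $R$ is a dividing rank if and only if $R$ has Weak bounded multiplicity.
   Context: $T$ is a complete first-order theory in a language $L$, with a monster model $\mathfrak C$ that is $\bar\kappa$-saturated and strongly $\bar\kappa$-homogeneous for a sufficiently large cardinal $\bar\kappa$ (e.g. strongly inaccessible). All parameter sets are small subsets of $\mathfrak C$ (cardinality $<\bar\kappa$), and cardinals quantified over in the definitions below are small. Complete types are finitary; $S(A)$ is the set of complete types over $A$; for a complete type $p\in S(A)$, $dom(p)=A$. A class of complete types is a class $\mathfrak A$ of complete types such that: if $p(x)\in\mathfrak A$ and $q(x)\supseteq p(x)$ is a complete type then $q\in\mathfrak A$; and if $p\in\mathfrak A$ and $f\in Aut(\mathfrak C)$ then the conjugate $p^f\in\mathfrak A$. A rank on $\mathfrak A$ is a mapping $R:\mathfrak A\to \mathrm{Ord}\cup\{\infty\}$ with Heredity ($p\subseteq q$ in $\mathfrak A$ implies $R(p)\ge R(q)$) and Isomorphism ($R(p)=R(p^f)$ for all $p\in\mathfrak A$, $f\in Aut(\mathfrak C)$). A type $p$ is ranked by $R$ if $R(p)<\infty$. $R$ is a dividing rank if for all $p\in S(A)$, $q\in S(B)$ in $\mathfrak A$ with $p\subseteq q$, $p$ ranked and $q$ dividing over $A$, one has $R(p)>R(q)$. A collection of types is $k$-inconsistent if the union of any $k$ of its (distinct) members is inconsistent. $R$ has Weak bounded multiplicity if for any ranked $p\in\mathfrak A$, any $k\ge 2$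 and any cardinal $\lambda$, there is a cardinal $\kappa$ such that any $k$-inconsistent collection of complete types $q$ extending $p$ with $|dom(q)|\le\lambda$, all with $R(q)=R(p)$, has cardinality at most $\kappa$. -}

module Defs where

open import Level using (Level; _⊔_) renaming (suc to lsuc)
open import Data.Bool.Base using (Bool)
open import Data.Fin.Base using (Fin)
open import Data.List.Base using (List)
import Data.List.Base as List
open import Data.List.Relation.Unary.All using (All)
import Data.List.Relation.Unary.All.Properties as Allₚ
import Data.List.Relation.Unary.All as AllL
open import Data.Nat.Base using (ℕ; suc; _+_)
import Data.Nat.Base as ℕ
open import Data.Product.Base using (Σ; ∃; _×_; _,_; proj₁; proj₂)
open import Data.Sum.Base using (_⊎_)
open import Data.Empty.Polymorphic using (⊥)
open import Data.Vec.Base using (Vec; []; _∷_; _++_; lookup)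
import Data.Vec.Base as Vec
import Data.Vec.Properties as Vecₚ
import Data.Vec.Relation.Unary.All as AllV
import Data.Vec.Relation.Unary.All.Properties as AllVₚ
open import Function.Base using (_∘_; id)
open import Function.Bundles
  using (Inverse; Injection; _↔_; _⇔_; mk⇔; module Equivalence)
open import Function.Definitions using (Injective)
open import Relation.Binary.Bundles using (Setoid)
import Relation.Binary.Construct.On as On
open import Relation.Binary.PropositionalEquality
  using (_≡_; refl; sym; trans; cong; cong₂; subst)
import Relation.Binary.PropositionalEquality as ≡
open import Relation.Nullary.Construct.Add.Supremum using (_⁺; [_]; ⊤⁺)
import Relation.Binary.Construct.Add.Supremum.Equality as AddEq
import Relation.Binary.Construct.Add.Supremum.NonStrict as AddNonStrict
import Relation.Binary.Construct.Add.Supremum.Strict as AddStrict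
open import Relation.Nullary.Negation.Core using (¬_)
open import Relation.Unary using (Pred; _⊆_; ⋃)

private variable
  ℓ a o c₁ c₂ e₁ e₂ : Level

-- Sets are compared through setoids because subsets and collections of
-- types are predicates, whose elements must be counted without their
-- membership proofs (and up to extensional equality).  A cardinal is
-- represented by a type with propositional equality.

∣_∣ : Set ℓ → Setoid ℓ ℓ
∣ X ∣ = ≡.setoid X

infix 4 _≼_ _≺_

_≼_ : Setoid c₁ e₁ → Setoid c₂ e₂ → Set (c₁ ⊔ e₁ ⊔ c₂ ⊔ e₂)
S ≼ T = Injection S T

_≺_ : Setoid c₁ e₁ → Setoid c₂ e₂ → Set (c₁ ⊔ e₁ ⊔ c₂ ⊔ e₂)
S ≺ T = S ≼ T × ¬ (T ≼ S)

infix 10 _↾_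

_↾_ : (S : Setoid c₁ e₁) → Pred (Setoid.Carrier S) c₂ → Setoid (c₁ ⊔ c₂) e₁
S ↾ P = On.setoid {B = Σ (Setoid.Carrier S) P} S proj₁

⟪_⟫ : {X : Set ℓ} → Pred X c₁ → Setoid (ℓ ⊔ c₁) ℓ
⟪_⟫ {X = X} A = ∣ X ∣ ↾ A

-- Ordinals: `lub⁺ I f` is the least ordinal strictly above every `f i`.

data Ord (o : Level) : Set (lsuc o) where
  lub⁺ : (I : Set o) → (I → Ord o) → Ord o

infix 4 _≤ᵒ_ _<ᵒ_ _≈ᵒ_

_≤ᵒ_ : Ord o → Ord o → Set o
lub⁺ I f ≤ᵒ lub⁺ J g = ∀ i → ∃ λ j → f i ≤ᵒ g j

_<ᵒ_ : Ord o → Ord o → Set o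
α <ᵒ lub⁺ J g = ∃ λ j → α ≤ᵒ g j

_≈ᵒ_ : Ord o → Ord o → Set o
α ≈ᵒ β = α ≤ᵒ β × β ≤ᵒ α

-- Ord ∪ {∞}, with ∞ written ⊤⁺.
Ord∞ : (o : Level) → Set (lsuc o)
Ord∞ o = Ord o ⁺

infix 4 _≤∞_ _<∞_ _≈∞_

_≤∞_ _<∞_ _≈∞_ : Ord∞ o → Ord∞ o → Set (lsuc o)
_≤∞_ = AddNonStrict._≤⁺_ _≤ᵒ_
_<∞_ = AddStrict._<⁺_ _<ᵒ_
_≈∞_ = AddEq._≈⁺_ _≈ᵒ_

record Language (ℓ : Level) : Set (lsuc ℓ) where
  field
    Fun : ℕ → Set ℓ
    Rel : ℕ → Set ℓ

  Symbol : Set ℓ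
  Symbol = ∃ Fun ⊎ ∃ Rel

module _ (L : Language ℓ) where
  open Language L

  data Term (n : ℕ) : Set ℓ where
    var : Fin n → Term n
    fun : ∀ {k} → Fun k → Vec (Term n) k → Term n

  infix  6 _≐_
  infixr 5 _⇒_

  -- The free variables are indexed by Fin n; `all` binds variable zero.
  -- The remaining connectives are classically definable.
  data Formula (n : ℕ) : Set ℓ where
    _≐_ : Term n → Term n → Formula n
    rel : ∀ {k} → Rel k → Vec (Term n) k → Formula n
    bot : Formula n
    _⇒_ : Formula n → Formula n → Formula n
    all : Formula (suc n) → Formula n

  record Structure : Set (lsuc ℓ) where
    field
      Carrier : Set ℓ
      point   : Carrier
      funᴵ    : ∀ {k} → Fun k → Vec Carrier k → Carrier
      relᴵ    : ∀ {k} → Rel k → Vec Carrier k → Set ℓ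

  Theory : Set (lsuc ℓ)
  Theory = Pred (Formula 0) ℓ

module _ {L : Language ℓ} where

  neg : ∀ {n} → Formula L n → Formula L n
  neg φ = φ ⇒ bot

  module _ (M : Structure L) where
    open Structure M

    mutual
      eval : ∀ {n} → Term L n → Vec Carrier n → Carrier
      eval (var i)    ρ = lookup ρ i
      eval (fun f ts) ρ = funᴵ f (evals ts ρ)

      evals : ∀ {n k} → Vec (Term L n) k → Vec Carrier n → Vec Carrier k
      evals []       ρ = []
      evals (t ∷ ts) ρ = eval t ρ ∷ evals ts ρ

    Sat : ∀ {n} → Formula L n → Vec Carrier n → Set ℓ
    Sat (s ≐ t)    ρ = eval s ρ ≡ eval t ρ
    Sat (rel r ts) ρ = relᴵ r (evals ts ρ)
    Sat bot        ρ = ⊥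
    Sat (φ ⇒ ψ)    ρ = Sat φ ρ → Sat ψ ρ
    Sat (all φ)    ρ = ∀ x → Sat φ (x ∷ ρ)

  _⊨ᵀ_ : Structure L → Theory L → Set ℓ
  M ⊨ᵀ T = ∀ σ → T σ → Sat M σ []

  _⊢ᵀ_ : Theory L → Formula L 0 → Set (lsuc ℓ)
  T ⊢ᵀ σ = ∀ (M : Structure L) → M ⊨ᵀ T → Sat M σ []

  -- Consistency of T is not required here: it follows once T has a model.
  CompleteTheory : Theory L → Set (lsuc ℓ)
  CompleteTheory T = ∀ σ → (T ⊢ᵀ σ) ⊎ (T ⊢ᵀ neg σ)

  record Automorphism (M : Structure L) : Set ℓ where
    open Structure M
    field
      bijection : Carrier ↔ Carrier
    open Inverse bijection public using (to; from; strictlyInverseˡ; strictlyInverseʳ)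
    field
      fun-hom : ∀ {k} (f : Language.Fun L k) xs →
                to (funᴵ f xs) ≡ funᴵ f (Vec.map to xs)
      rel-hom : ∀ {k} (r : Language.Rel L k) xs →
                relᴵ r xs ⇔ relᴵ r (Vec.map to xs)

    to-injective : ∀ {x y} → to x ≡ to y → x ≡ y
    to-injective {x} {y} e =
      trans (sym (strictlyInverseʳ x)) (trans (cong from e) (strictlyInverseʳ y))

    from-injective : ∀ {x y} → from x ≡ from y → x ≡ y
    from-injective {x} {y} e =
      trans (sym (strictlyInverseˡ x)) (trans (cong to e) (strictlyInverseˡ y))

  module _ {M : Structure L} (f : Automorphism M) where
    open Structure M
    open Automorphism f

    mutual
      eval-aut : ∀ {n} (t : Term L n) (ρ : Vec Carrier n) →
                 to (eval M t ρ) ≡ eval M t (Vec.map to ρ)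
      eval-aut (var i)    ρ = sym (Vecₚ.lookup-map i to ρ)
      eval-aut (fun g ts) ρ =
        trans (fun-hom g (evals M ts ρ)) (cong (funᴵ g) (evals-aut ts ρ))

      evals-aut : ∀ {n k} (ts : Vec (Term L n) k) (ρ : Vec Carrier n) →
                  Vec.map to (evals M ts ρ) ≡ evals M ts (Vec.map to ρ)
      evals-aut []       ρ = refl
      evals-aut (t ∷ ts) ρ = cong₂ _∷_ (eval-aut t ρ) (evals-aut ts ρ)

    Sat-aut : ∀ {n} (φ : Formula L n) (ρ : Vec Carrier n) →
              Sat M φ ρ ⇔ Sat M φ (Vec.map to ρ)
    Sat-aut (s ≐ t) ρ = mk⇔
      (λ e → trans (sym (eval-aut s ρ)) (trans (cong to e) (eval-aut t ρ)))
      (λ e → to-injective (trans (eval-aut s ρ) (trans e (sym (eval-aut t ρ)))))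
    Sat-aut (rel r ts) ρ = mk⇔
      (λ h → subst (relᴵ r) (evals-aut ts ρ)
               (Equivalence.to (rel-hom r (evals M ts ρ)) h))
      (λ h → Equivalence.from (rel-hom r (evals M ts ρ))
               (subst (relᴵ r) (sym (evals-aut ts ρ)) h))
    Sat-aut bot     ρ = mk⇔ id id
    Sat-aut (φ ⇒ ψ) ρ = mk⇔
      (λ h → Equivalence.to (Sat-aut ψ ρ) ∘ h ∘ Equivalence.from (Sat-aut φ ρ))
      (λ h → Equivalence.from (Sat-aut ψ ρ) ∘ h ∘ Equivalence.to (Sat-aut φ ρ))
    Sat-aut (all φ) ρ = mk⇔
      (λ h x → subst (λ y → Sat M φ (y ∷ Vec.map to ρ)) (strictlyInverseˡ x)
                 (Equivalence.to (Sat-aut φ (from x ∷ ρ)) (h (from x))))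
      (λ h x → Equivalence.from (Sat-aut φ (x ∷ ρ)) (h (to x)))

-- Types in a fixed structure M; the type K represents the cardinal κ̄.

module _ {L : Language ℓ} (M : Structure L) where
  open Structure M

  -- A formula φ(x; a) in the variables x = (x₀, …, xₙ₋₁) with parameters
  -- a from M.
  record PFormula (n : ℕ) : Set ℓ where
    constructor _⟨_⟩
    field
      {arity} : ℕ
      formula : Formula L (n + arity)
      params  : Vec Carrier arity

  infix 4 _⊨_

  _⊨_ : ∀ {n} → Vec Carrier n → PFormula n → Set ℓ
  c ⊨ (φ ⟨ a ⟩) = Sat M φ (c ++ a)

  Consistent : ∀ {n} → Pred (PFormula n) ℓ → Set ℓ
  Consistent Γ = ∀ Δ → All Γ Δ → ∃ λ c → All (c ⊨_) Δ

  Realized : ∀ {n} → Pred (PFormula n) ℓ → Set ℓ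
  Realized Γ = ∃ λ c → Γ ⊆ (c ⊨_)

  mapParams : ∀ {n} → (Carrier → Carrier) → PFormula n → PFormula n
  mapParams f (φ ⟨ a ⟩) = φ ⟨ Vec.map f a ⟩

module _ {L : Language ℓ} (M : Structure L) (K : Set ℓ) where
  open Structure M

  Small : Pred Carrier ℓ → Set ℓ
  Small A = ⟪ A ⟫ ≺ ∣ K ∣

  record CompleteType (n : ℕ) : Set (lsuc ℓ) where
    field
      dom        : Pred Carrier ℓ
      formulas   : Pred (PFormula M n) ℓ
      small      : Small dom
      over       : ∀ {θ} → formulas θ → AllV.All dom (PFormula.params θ)
      consistent : Consistent M formulas
      complete   : ∀ {m} (φ : Formula L (n + m)) {a} → AllV.All dom a →
                   formulas (φ ⟨ a ⟩) ⊎ formulas (neg φ ⟨ a ⟩)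

module _ {L : Language ℓ} {M : Structure L} {K : Set ℓ} where
  open Structure M
  open CompleteType

  infix 4 _⊑_ _≋_

  _⊑_ : ∀ {n} → CompleteType M K n → CompleteType M K n → Set ℓ
  p ⊑ q = formulas p ⊆ formulas q

  -- Equality of complete types; it entails that the domains coincide, as
  -- a type over A contains a formula mentioning each element of A.
  _≋_ : ∀ {n} → CompleteType M K n → CompleteType M K n → Set ℓ
  p ≋ q = p ⊑ q × q ⊑ p

  typeSetoid : ℕ → Setoid (lsuc ℓ) ℓ
  typeSetoid n = record
    { Carrier = CompleteType M K n
    ; _≈_ = _≋_
    ; isEquivalence = record
      { refl  = id , id
      ; sym   = λ (s , t) → t , s
      ; trans = λ (s , t) (s′ , t′) → (λ x → s′ (s x)) , (λ x → t (t′ x))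
      }
    }

  -- The conjugate p^f = { φ(x; f a) ∣ φ(x; a) ∈ p }, over f[dom p].
  conj : ∀ {n} → Automorphism M → CompleteType M K n → CompleteType M K n
  conj {n} f p = record
    { dom        = λ b → dom p (from b)
    ; formulas   = λ θ → formulas p (mapParams M from θ)
    ; small      = restrict (proj₁ (small p)) , λ i → proj₂ (small p) (extend i)
    ; over       = λ h → AllVₚ.map⁻ (over p h)
    ; consistent = λ Δ h →
        let (c , s) = consistent p (List.map (mapParams M from) Δ) (Allₚ.map⁺ h)
        in Vec.map to c , AllL.map (λ {θ} → push c θ) (Allₚ.map⁻ s)
    ; complete   = λ φ h → complete p φ (AllVₚ.map⁺ h)
    }
    where
    open Automorphism f

    restrict : ⟪ dom p ⟫ ≼ ∣ K ∣ → ⟪ (λ b → dom p (from b)) ⟫ ≼ ∣ K ∣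
    restrict i = record
      { to        = λ (b , h) → Injection.to i (from b , h)
      ; cong      = λ e → Injection.cong i (cong from e)
      ; injective = λ e → from-injective (Injection.injective i e)
      }

    extend : ∣ K ∣ ≼ ⟪ (λ b → dom p (from b)) ⟫ → ∣ K ∣ ≼ ⟪ dom p ⟫
    extend i = record
      { to        = λ k → let (b , h) = Injection.to i k in from b , h
      ; cong      = λ e → cong from (Injection.cong i e)
      ; injective = λ e → Injection.injective i (from-injective e)
      }

    push : ∀ c (θ : PFormula M n) →
           _⊨_ M c (mapParams M from θ) → _⊨_ M (Vec.map to c) θ
    push c (φ ⟨ a ⟩) h =
      subst (Sat M φ)
        (trans (Vecₚ.map-++ to c (Vec.map from a))
          (cong (Vec.map to c ++_)
            (trans (sym (Vecₚ.map-∘ to from a))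
              (trans (Vecₚ.map-cong strictlyInverseˡ a) (Vecₚ.map-id a)))))
        (Equivalence.to (Sat-aut f φ (c ++ Vec.map from a)) h)

-- κ̄ is an uncountable strong limit cardinal above |L|; this includes all
-- strongly inaccessible κ̄ > |L|.
record SufficientlyLarge (L : Language ℓ) (K : Set ℓ) : Set (lsuc ℓ) where
  field
    uncountable : ∣ ℕ ∣ ≺ ∣ K ∣
    strongLimit : ∀ (X : Set ℓ) → ∣ X ∣ ≺ ∣ K ∣ → ∣ (X → Bool) ∣ ≺ ∣ K ∣
    language<κ̄  : ∣ Language.Symbol L ∣ ≺ ∣ K ∣

record MonsterModel {L : Language ℓ} (T : Theory L) (K : Set ℓ) : Set (lsuc ℓ) where
  field
    structure   : Structure L
  open Structure structure
  field
    model       : structure ⊨ᵀ T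
    saturated   : ∀ {n} (p : CompleteType structure K n) →
                  Realized structure (CompleteType.formulas p)
    homogeneous : ∀ (I : Set ℓ) → ∣ I ∣ ≺ ∣ K ∣ → (a b : I → Carrier) →
                  (∀ {m} (φ : Formula L m) (i : Vec I m) →
                    Sat structure φ (Vec.map a i) ⇔ Sat structure φ (Vec.map b i)) →
                  ∃ λ (f : Automorphism structure) → ∀ i → Automorphism.to f (a i) ≡ b i

module Ranks {L : Language ℓ} {T : Theory L} {K : Set ℓ} (𝕮 : MonsterModel T K) where
  open MonsterModel 𝕮 renaming (structure to M)
  open Structure M
  open CompleteType

  Type : ℕ → Set (lsuc ℓ)
  Type = CompleteType M K

  SameType : ∀ {m} → Pred Carrier ℓ → Vec Carrier m → Vec Carrier m → Set ℓ
  SameType {m} A b b′ =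
    ∀ {l} (φ : Formula L (m + l)) {a} → AllV.All A a →
    (_⊨_ M b (φ ⟨ a ⟩)) ⇔ (_⊨_ M b′ (φ ⟨ a ⟩))

  FormulaDivides : ∀ {n} → PFormula M n → Pred Carrier ℓ → Set ℓ
  FormulaDivides (φ ⟨ b ⟩) A =
    ∃ λ (k : ℕ) → ∃ λ (bs : ℕ → Vec Carrier _) →
      (∀ i → SameType A (bs i) b) ×
      (∀ (s : Fin k → ℕ) → Injective _≡_ _≡_ s →
        ¬ ∃ λ c → ∀ j → _⊨_ M c (φ ⟨ bs (s j) ⟩))

  -- Consequence modulo the elementary diagram of 𝕮 (by compactness,
  -- finitely many members of Γ suffice).
  _⊢_ : ∀ {n} → Pred (PFormula M n) ℓ → PFormula M n → Set ℓ
  Γ ⊢ θ = ∃ λ Δ → All Γ Δ × (∀ c → All (_⊨_ M c) Δ → _⊨_ M c θ)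

  _Divides_ : ∀ {n} → Type n → Pred Carrier ℓ → Set ℓ
  q Divides A = ∃ λ θ → formulas q ⊢ θ × FormulaDivides θ A

  record TypeClass (a : Level) : Set (lsuc ℓ ⊔ lsuc a) where
    field
      Member    : ∀ {n} → Type n → Set a
      extension : ∀ {n} {p q : Type n} → Member p → p ⊑ q → Member q
      conjugate : ∀ {n} {p : Type n} → Member p → ∀ f → Member (conj f p)

  -- `heredity` makes `rank` independent of the membership proofs and
  -- invariant under equality of types, up to _≈∞_.
  record Rank (𝔄 : TypeClass a) (o : Level) : Set (lsuc ℓ ⊔ a ⊔ lsuc o) where
    open TypeClass 𝔄
    field
      rank        : ∀ {n} (p : Type n) → Member p → Ord∞ o
      heredity    : ∀ {n} {p q : Type n} (hp : Member p) (hq : Member q) →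
                    p ⊑ q → rank q hq ≤∞ rank p hp
      isomorphism : ∀ {n} {p : Type n} (hp : Member p) f →
                    rank p hp ≈∞ rank (conj f p) (conjugate hp f)

    Ranked : ∀ {n} (p : Type n) → Member p → Set (lsuc o)
    Ranked p hp = rank p hp <∞ ⊤⁺

  -- A collection Q of types, given as a predicate.
  _-Inconsistent_ : ∀ {n} → ℕ → Pred (Type n) (lsuc ℓ) → Set (lsuc ℓ)
  k -Inconsistent Q =
    ∀ (r : Fin k → Type _) → (∀ i → Q (r i)) → Injective _≡_ _≋_ r →
    ¬ Consistent M (⋃ (Fin k) (λ i → formulas (r i)))

  module _ {𝔄 : TypeClass a} (R : Rank 𝔄 o) where
    open TypeClass 𝔄
    open Rank R

    DividingRank : Set (lsuc ℓ ⊔ a ⊔ lsuc o)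
    DividingRank =
      ∀ {n} (p q : Type n) (hp : Member p) (hq : Member q) →
      p ⊑ q → Ranked p hp → q Divides (dom p) → rank q hq <∞ rank p hp

    WeakBoundedMultiplicity : Set (lsuc (lsuc ℓ) ⊔ a ⊔ lsuc o)
    WeakBoundedMultiplicity =
      ∀ {n} (p : Type n) (hp : Member p) → Ranked p hp →
      ∀ (k : ℕ) → 2 ℕ.≤ k →
      ∀ (Λ : Set ℓ) → ∣ Λ ∣ ≺ ∣ K ∣ →
      ∃ λ (κ : Set ℓ) → ∣ κ ∣ ≺ ∣ K ∣ ×
        (∀ (Q : Pred (Type n) (lsuc ℓ)) → k -Inconsistent Q →
          (∀ q → Q q → Σ (p ⊑ q) λ p⊑q →
            ⟪ dom q ⟫ ≼ ∣ Λ ∣ ×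
            rank q (extension hp p⊑q) ≈∞ rank p hp) →
          typeSetoid n ↾ Q ≼ ∣ κ ∣)

-- For a dividing rank, suppose there were too many extensions of p with the
-- rank of p.  Enumerate the parameters of each by Λ.  Boundedly many "shapes"
-- (the type of the parameters over dom p together with the formulas of the
-- type) occur, so one shape is shared by too many of them.  Any k of these are
-- inconsistent because of some finite list of formulas; this list colours the
-- k-tuples, and an infinite homogeneous set given by the Erdős–Rado theorem
-- shows that the conjunction of a single list divides over dom p, so the rank
-- drops.
--
-- Conversely, let q ⊇ p divide over dom p by φ(x, b) and a sequence bs, and let
-- q have the rank of p.  Finitary saturation suffices to stretch bs to any small
-- length: fix a nonprincipal ultrafilter on ℕ and realise recursively the
-- average type of bs over bs and everything chosen before.  Any k distinct
-- instances of φ remain inconsistent, as members of the new sequence can be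
-- replaced by members of bs starting from the last one.  Conjugates of q over
-- dom p along this sequence form a k-inconsistent collection which is too large.
module Submission where

open import Defs
open import Axiom.ExcludedMiddle using (ExcludedMiddle)
open import Axiom.Extensionality.Propositional using (Extensionality; implicit-extensionality)
open import Data.Bool.Base using (Bool; true; false; not)
open import Data.Bool.Properties using (not-injective)
open import Data.Empty.Polymorphic using (⊥; ⊥-elim)
open import Data.Fin.Base as Fin using (Fin; zero; suc; toℕ; splitAt; _↑ˡ_; _↑ʳ_)
open import Data.Fin.Properties using (toℕ-injective)
open import Data.List.Base as List using (List; []; _∷_)
open import Data.List.Properties using (∷-injective)
open import Data.List.Relation.Unary.All as AllL using ([]; _∷_)
import Data.List.Relation.Unary.All.Properties as Allₚ
open import Data.Maybe.Base using (Maybe; just; nothing)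
open import Data.Maybe.Properties using (just-injective)
open import Data.Nat.Base as ℕ using (ℕ; zero; suc; _+_; s≤s; z≤n)
import Data.Nat.Properties as ℕₚ
open import Data.Product.Base using (Σ; ∃; _×_; _,_; proj₁; proj₂)
open import Data.Sum.Base as Sum using (_⊎_; inj₁; inj₂; [_,_]′)
open import Data.Sum.Properties using (inj₁-injective)
open import Data.Vec.Base as Vec using (Vec; []; _∷_; _++_; lookup; tabulate; toList)
import Data.Vec.Properties as Vecₚ
open import Data.Vec.Relation.Binary.Pointwise.Inductive as Pointwise using (Pointwise; []; _∷_)
open import Data.Vec.Relation.Unary.All as AllV using ([]; _∷_)
import Data.Vec.Relation.Unary.All.Properties as AllVₚ
open import Data.Vec.Relation.Unary.AllPairs as AllPairs using (AllPairs; []; _∷_)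
open import Data.Vec.Relation.Unary.Unique.Propositional using (Unique)
import Data.Vec.Relation.Unary.Unique.Propositional.Properties as Uniqueₚ
open import Function.Base using (_∘_; id; _on_)
open import Function.Bundles using (Injection; mk↣; _⇔_; mk⇔; module Equivalence)
import Function.Construct.Composition as Composition
open import Function.Definitions using (Injective)
open import Induction.WellFounded using (WfRec; Acc; acc; WellFounded; wf⇒asym; module All; module FixPoint)
open import Level using (Level; _⊔_; Lift; lift; lower) renaming (suc to lsuc)
open import Relation.Binary.Bundles using (Setoid)
import Relation.Binary.Construct.Add.Supremum.Equality as AddEq
import Relation.Binary.Construct.Add.Supremum.NonStrict as AddNonStrict
import Relation.Binary.Construct.Add.Supremum.Strict as AddStrict
import Relation.Binary.Construct.On as On
open import Relation.Binary.PropositionalEquality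
open import Relation.Nullary using (¬_; does; yes; no; contradiction)
open import Relation.Nullary.Construct.Add.Supremum using ([_]; ⊤⁺)
open import Relation.Nullary.Decidable using (decidable-stable; dec-true)
open import Relation.Unary using (Pred)

private variable
  a b c e₁ e₂ e₃ o p ℓ : Level
  k l m n n′ : ℕ

-- Embeddings of setoids; elementary facts on lists and vectors.

≼-trans : {S : Setoid a e₁} {T : Setoid b e₂} {U : Setoid c e₃} → S ≼ T → T ≼ U → S ≼ U
≼-trans = Composition.injection

≼-≺-trans : {S : Setoid a e₁} {T : Setoid b e₂} {U : Setoid c e₃} → S ≼ T → T ≺ U → S ≺ U
≼-≺-trans i (j , ¬j) = ≼-trans i j , λ k → ¬j (≼-trans k i)

nth : {X : Set a} → List X → ℕ → Maybe X
nth []       _       = nothing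
nth (x ∷ _)  zero    = just x
nth (_ ∷ xs) (suc n) = nth xs n

nth-injective : {X : Set a} {xs ys : List X} → (∀ n → nth xs n ≡ nth ys n) → xs ≡ ys
nth-injective {xs = []}     {[]}     h = refl
nth-injective {xs = []}     {_ ∷ _}  h with () ← h 0
nth-injective {xs = _ ∷ _}  {[]}     h with () ← h 0
nth-injective {xs = x ∷ xs} {y ∷ ys} h =
  cong₂ _∷_ (just-injective (h 0)) (nth-injective (h ∘ suc))

fresh : (w : Vec ℕ n) → ∃ λ i → AllV.All (i ≢_) w
fresh w = let (N , w<N) = bounded w in N , AllV.map (λ j<N → ≢-sym (ℕₚ.<⇒≢ j<N)) w<N
  where
  bounded : (w : Vec ℕ n) → ∃ λ N → AllV.All (ℕ._< N) w
  bounded []      = 0 , AllV.[]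
  bounded (x ∷ w) = let (N , w<N) = bounded w in
    suc x + N , ℕₚ.m≤m+n (suc x) N AllV.∷ AllV.map (λ j<N → ℕₚ.<-≤-trans j<N (ℕₚ.m≤n+m N (suc x))) w<N

map-cover : {X : Set a} {Y : Set b} {A : Pred X c} (g : Y → X) →
            (∀ {x} → A x → ∃ λ y → g y ≡ x) →
            ∀ {xs : Vec X n} → AllV.All A xs → ∃ λ ys → Vec.map g ys ≡ xs
map-cover g cover AllV.[] = [] , refl
map-cover g cover (ax AllV.∷ axs) =
  let (y , e) = cover ax ; (ys , es) = map-cover g cover axs in y ∷ ys , cong₂ _∷_ e es

-- The linear order of the ordinals, with and without infinity.

module Ordinals (em : ∀ {a} → ExcludedMiddle a) where

  ≤ᵒ-refl : {α : Ord o} → α ≤ᵒ α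
  ≤ᵒ-refl {α = lub⁺ I f} i = i , ≤ᵒ-refl

  ≤ᵒ-trans : {α β γ : Ord o} → α ≤ᵒ β → β ≤ᵒ γ → α ≤ᵒ γ
  ≤ᵒ-trans {α = lub⁺ _ _} {lub⁺ _ _} {lub⁺ _ _} p q i =
    let (j , fi≤gj) = p i
        (k , gj≤hk) = q j
    in k , ≤ᵒ-trans fi≤gj gj≤hk

  <-≤-trans : {α β γ : Ord o} → α <ᵒ β → β ≤ᵒ γ → α <ᵒ γ
  <-≤-trans {β = lub⁺ _ _} {lub⁺ _ _} (j , p) q =
    let (k , r) = q j in k , ≤ᵒ-trans p r

  <⇒≤ : {α β : Ord o} → α <ᵒ β → α ≤ᵒ β
  <⇒≤ {α = lub⁺ _ _} {lub⁺ _ g} (j , p) i = j , <⇒≤ (<-≤-trans (i , ≤ᵒ-refl) p)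

  ≤-intro : ∀ {I : Set o} {f : I → Ord o} {β} → (∀ i → f i <ᵒ β) → lub⁺ I f ≤ᵒ β
  ≤-intro {β = lub⁺ _ _} h = h

  -- If some `f i` is not below `lub⁺ J g`, it is at most no `g j`, so by induction every `g j` is
  -- below it.
  ≤-or-> : (α β : Ord o) → α ≤ᵒ β ⊎ β <ᵒ α
  ≤-or-> (lub⁺ I f) (lub⁺ J g) with em {P = ∃ λ i → ¬ f i <ᵒ lub⁺ J g}
  ... | no  none     = inj₁ λ i → decidable-stable em λ h → none (i , h)
  ... | yes (i , fi≮β) = inj₂ (i , ≤-intro λ j → below j (≤-or-> (f i) (g j)))
    where
    below : ∀ j → f i ≤ᵒ g j ⊎ g j <ᵒ f i → g j <ᵒ f i
    below j (inj₁ fi≤gj) = contradiction (j , fi≤gj) fi≮β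
    below j (inj₂ gj<fi) = gj<fi

  <ᵒ-wellFounded : WellFounded (_<ᵒ_ {o})
  <ᵒ-wellFounded (lub⁺ J g) = acc λ (j , p) → down p (<ᵒ-wellFounded (g j))
    where
    down : ∀ {α β} → α ≤ᵒ β → Acc _<ᵒ_ β → Acc _<ᵒ_ α
    down α≤β (acc rs) = acc λ γ<α → rs (<-≤-trans γ<α α≤β)

  <ᵒ-irrefl : {α : Ord o} → ¬ α <ᵒ α
  <ᵒ-irrefl p = wf⇒asym <ᵒ-wellFounded p p

  <⇒≱ : {α β : Ord o} → α <ᵒ β → ¬ β ≤ᵒ α
  <⇒≱ p q = <ᵒ-irrefl (<-≤-trans p q)

  ≈ᵒ-sym : {α β : Ord o} → α ≈ᵒ β → β ≈ᵒ α
  ≈ᵒ-sym (p , q) = q , p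

  ≈ᵒ-trans : {α β γ : Ord o} → α ≈ᵒ β → β ≈ᵒ γ → α ≈ᵒ γ
  ≈ᵒ-trans (p , q) (p′ , q′) = ≤ᵒ-trans p p′ , ≤ᵒ-trans q′ q

  module _ {o : Level} where
    private variable
      α β γ : Ord∞ o

    ≈∞-sym : α ≈∞ β → β ≈∞ α
    ≈∞-sym = AddEq.≈⁺-sym _ ≈ᵒ-sym

    ≈∞-trans : α ≈∞ β → β ≈∞ γ → α ≈∞ γ
    ≈∞-trans = AddEq.≈⁺-trans _ ≈ᵒ-trans

    ≤∞-antisym : α ≤∞ β → β ≤∞ α → α ≈∞ β
    ≤∞-antisym = AddNonStrict.≤⁺-antisym _ _,_

    ≈∞⇒≮∞ : α ≈∞ β → ¬ α <∞ β
    ≈∞⇒≮∞ AddEq.[ _ , β≤α ] AddStrict.[ α<β ] = <⇒≱ α<β β≤α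

    -- This turns the failure of a strict drop of rank into equality of ranks.
    ≮∞⇒≈∞ : α ≤∞ β → ¬ α <∞ β → α ≈∞ β
    ≮∞⇒≈∞ (AddNonStrict.[_] {k = α} {l = β} α≤β) ≮ with ≤-or-> β α
    ... | inj₁ β≤α = AddEq.[ α≤β , β≤α ]
    ... | inj₂ α<β = contradiction AddStrict.[ α<β ] ≮
    ≮∞⇒≈∞ (⊤⁺ AddNonStrict.≤⊤⁺) ≮ = AddEq.⊤⁺≈⊤⁺
    ≮∞⇒≈∞ ([ α ] AddNonStrict.≤⊤⁺) ≮ = contradiction AddStrict.[ α ]<⊤⁺ ≮

-- Classical logic and the well-ordering theorem.

module Classical (em : ∀ {a} → ExcludedMiddle a)
                 (ext : ∀ {a b} → Extensionality a b) where
  open Ordinals em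

  -- Booleans stand in for truth values: with extensionality, equivalent predicates become equal and
  -- proofs of membership unique.
  ⟦_⟧ : Set a → Bool
  ⟦ P ⟧ = does (em {P = P})

  ⟦⟧-true : {P : Set a} → P → ⟦ P ⟧ ≡ true
  ⟦⟧-true = dec-true em

  ⟦⟧-true⁻¹ : {P : Set a} → ⟦ P ⟧ ≡ true → P
  ⟦⟧-true⁻¹ {P = P} e with yes p ← em {P = P} = p

  ⟦⟧-cong : {P : Set a} {Q : Set b} → (P → Q) → (Q → P) → ⟦ P ⟧ ≡ ⟦ Q ⟧
  ⟦⟧-cong {P = P} {Q} f g with em {P = P} | em {P = Q}
  ... | yes p | yes q = refl
  ... | yes p | no ¬q = contradiction (f p) ¬q
  ... | no ¬p | yes q = contradiction (g q) ¬p
  ... | no ¬p | no ¬q = refl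

  ⟦⟧-cong⁻¹ : {P : Set a} {Q : Set b} → ⟦ P ⟧ ≡ ⟦ Q ⟧ → P → Q
  ⟦⟧-cong⁻¹ e p = ⟦⟧-true⁻¹ (trans (sym e) (⟦⟧-true p))

  -- Excluded middle for all types, not only for propositions, is a choice
  -- operator.
  choose : {P : Set a} → ¬ ¬ P → P
  choose = decidable-stable em

  abstract
    -- Extensionality makes the step indifferent to accessibility proofs, which gives the unfolding
    -- equation. Later constructions rest on that equation alone, the recursion being `abstract`.
    wf-recursion : ∀ {A : Set a} {_<_ : A → A → Set b} → WellFounded _<_ →
                   {P : A → Set c} (f : ∀ x → (∀ {y} → y < x → P y) → P x) →
                   ∃ λ (g : ∀ x → P x) → ∀ x → g x ≡ f x (λ {y} _ → g y)
    wf-recursion {_<_ = _<_} wf {P} f = All.wfRec wf _ P f , λ x → FixPoint.unfold-wfRec wf P f f-ext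
      where
      f-ext : ∀ x {IH IH′ : WfRec _<_ P x} →
              (∀ {y} y<x → IH {y} y<x ≡ IH′ y<x) → f x IH ≡ f x IH′
      f-ext x e = cong (λ (IH : WfRec _<_ P x) → f x IH) (implicit-extensionality ext (ext e))

  -- An enumeration of order type `length`. Indices taken from the ordinals make any two
  -- well-orderings directly comparable.
  record WellOrdering (X : Set a) : Set (lsuc a) where
    field
      length     : Ord a
      index      : X → Ord a
      index<     : ∀ x → index x <ᵒ length
      injective  : ∀ {x y} → index x ≈ᵒ index y → x ≡ y
      surjective : ∀ {β} → β <ᵒ length → ∃ λ x → index x ≈ᵒ β

    infix 4 _⊏_
    _⊏_ : X → X → Set a
    _⊏_ = _<ᵒ_ on index

    ⊏-wellFounded : WellFounded _⊏_
    ⊏-wellFounded = On.wellFounded index <ᵒ-wellFounded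

    ⊏-trans : ∀ {x y z} → x ⊏ y → y ⊏ z → x ⊏ z
    ⊏-trans p q = <-≤-trans p (<⇒≤ q)

    ⊏-irrefl : ∀ {x} → ¬ x ⊏ x
    ⊏-irrefl = <ᵒ-irrefl

    ⊏-tri : ∀ x y → x ⊏ y ⊎ x ≡ y ⊎ y ⊏ x
    ⊏-tri x y with ≤-or-> (index x) (index y) | ≤-or-> (index y) (index x)
    ... | inj₂ y<x | _        = inj₂ (inj₂ y<x)
    ... | inj₁ x≤y | inj₁ y≤x = inj₂ (inj₁ (injective (x≤y , y≤x)))
    ... | inj₁ _   | inj₂ x<y = inj₁ x<y

  -- Iterating along all ordinals a choice of an element not chosen before
  -- must exhaust X: otherwise the stages at which elements are chosen would
  -- be cofinal in the ordinals.
  choiceOrdering : (X : Set a) → WellOrdering X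
  choiceOrdering {a} X = record
    { length     = Ω
    ; index      = index
    ; index<     = λ x → proj₁ (proj₂ (index-spec x))
    ; injective  = index-injective
    ; surjective = surj
    }
    where
    pick : (X → Bool) → Maybe X
    pick S with em {P = ∃ λ x → S x ≡ false}
    ... | yes (x , _) = just x
    ... | no  _       = nothing

    pick-new : ∀ S {x} → pick S ≡ just x → S x ≡ false
    pick-new S e with yes (_ , new) ← em {P = ∃ λ x → S x ≡ false} | refl ← e = new

    pick-all : ∀ S → pick S ≡ nothing → ∀ x → S x ≡ true
    pick-all S e x with no none ← em {P = ∃ λ x → S x ≡ false} with S x in eq
    ... | true  = refl
    ... | false = contradiction (x , eq) none

    used : ∀ α → (∀ {β} → β <ᵒ α → Maybe X) → X → Bool
    used α h x = ⟦ (∃ λ β → Σ (β <ᵒ α) λ β<α → h β<α ≡ just x) ⟧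

    recursion : ∃ λ (g : Ord a → Maybe X) → ∀ α → g α ≡ pick (used α λ {β} _ → g β)
    recursion = wf-recursion <ᵒ-wellFounded {P = λ _ → Maybe X} (λ α h → pick (used α h))

    stage : Ord a → Maybe X
    stage = proj₁ recursion

    usedAt : Ord a → X → Bool
    usedAt α = used α (λ {β} _ → stage β)

    stage-eq : ∀ α → stage α ≡ pick (usedAt α)
    stage-eq = proj₂ recursion

    stage-fresh : ∀ {α β x} → β <ᵒ α → stage β ≡ just x → ¬ stage α ≡ just x
    stage-fresh {α} {β} {x} β<α e e′
      with () ← trans (sym (⟦⟧-true (β , β<α , e)))
                  (pick-new (usedAt α) (trans (sym (stage-eq α)) e′))

    stage-cong : ∀ {α β} → α ≈ᵒ β → stage α ≡ stage β
    stage-cong {α} {β} (α≤β , β≤α) =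
      trans (stage-eq α) (trans (cong pick (ext λ x →
        ⟦⟧-cong (λ (γ , p , e) → γ , <-≤-trans p α≤β , e)
                (λ (γ , p , e) → γ , <-≤-trans p β≤α , e))) (sym (stage-eq β)))

    stage-injective : ∀ {α β x} → stage α ≡ just x → stage β ≡ just x → α ≈ᵒ β
    stage-injective {α} {β} e e′ with ≤-or-> α β | ≤-or-> β α
    ... | inj₂ β<α | _        = contradiction e (stage-fresh β<α e′)
    ... | inj₁ _   | inj₂ α<β = contradiction e′ (stage-fresh α<β e)
    ... | inj₁ α≤β | inj₁ β≤α = α≤β , β≤α

    exhausted : ∃ λ α → stage α ≡ nothing
    exhausted = choose λ none → burali-forti none
      where
      stageOf : X → Ord a
      stageOf x with em {P = ∃ λ α → stage α ≡ just x}
      ... | yes (α , _) = α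
      ... | no  _       = lub⁺ ⊥ λ ()

      stageOf-eq : ∀ {α x} → stage α ≡ just x → stage (stageOf x) ≡ just x
      stageOf-eq {α} {x} e with em {P = ∃ λ α → stage α ≡ just x}
      ... | yes (_ , e′) = e′
      ... | no  none     = contradiction (α , e) none

      burali-forti : ¬ ¬ ∃ λ α → stage α ≡ nothing
      -- As `X` lies in `Set a`, the stages of its elements have a strict upper bound in `Ord a`; an
      -- element picked there would have been picked before.
      burali-forti none with stage (lub⁺ X stageOf) in eq
      ... | nothing = none (_ , eq)
      ... | just x  = stage-fresh (x , ≤ᵒ-refl) (stageOf-eq eq) eq

    -- Leastness makes every ordinal below `Ω` the stage of some element, as `surjective` demands.
    least : ∃ λ α → stage α ≡ nothing × (∀ {β} → β <ᵒ α → ¬ stage β ≡ nothing)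
    least = go (<ᵒ-wellFounded _) (proj₂ exhausted)
      where
      go : ∀ {α} → Acc _<ᵒ_ α → stage α ≡ nothing →
           ∃ λ α → stage α ≡ nothing × (∀ {β} → β <ᵒ α → ¬ stage β ≡ nothing)
      go {α} (acc rs) e with em {P = ∃ λ β → β <ᵒ α × stage β ≡ nothing}
      ... | yes (β , β<α , e′) = go (rs β<α) e′
      ... | no  none           = α , e , λ p e′ → none (_ , p , e′)

    Ω : Ord a
    Ω = proj₁ least

    index-spec : ∀ x → ∃ λ α → α <ᵒ Ω × stage α ≡ just x
    index-spec x =
      ⟦⟧-true⁻¹ (pick-all (usedAt Ω) (trans (sym (stage-eq Ω)) (proj₁ (proj₂ least))) x)

    index : X → Ord a
    index x = proj₁ (index-spec x)

    index-injective : ∀ {x y} → index x ≈ᵒ index y → x ≡ y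
    index-injective {x} {y} e = just-injective
      (trans (sym (proj₂ (proj₂ (index-spec x))))
        (trans (stage-cong e) (proj₂ (proj₂ (index-spec y)))))

    surj : ∀ {β} → β <ᵒ Ω → ∃ λ x → index x ≈ᵒ β
    surj {β} β<Ω with stage β in eq
    ... | nothing = contradiction eq (proj₂ (proj₂ least) β<Ω)
    ... | just x  = x , stage-injective (proj₂ (proj₂ (index-spec x))) eq

  abstract
    zermelo : (X : Set a) → WellOrdering X
    zermelo = choiceOrdering

  module _ {X Y : Set a} (𝐱 : WellOrdering X) (𝐲 : WellOrdering Y) where
    private
      module 𝐱 = WellOrdering 𝐱
      module 𝐲 = WellOrdering 𝐲

    -- Each element goes to the one at the same position, which exists because `Y` is at least as
    -- long.
    initial-segment : 𝐱.length ≤ᵒ 𝐲.length → ∣ X ∣ ≼ ∣ Y ∣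
    initial-segment le = mk↣ image-injective
      where
      image : ∀ x → ∃ λ y → 𝐲.index y ≈ᵒ 𝐱.index x
      image x = 𝐲.surjective (<-≤-trans (𝐱.index< x) le)

      image-injective : Injective _≡_ _≡_ (proj₁ ∘ image)
      image-injective {x} {x′} e = 𝐱.injective (≈ᵒ-trans (≈ᵒ-sym (proj₂ (image x)))
        (subst (λ y → 𝐲.index y ≈ᵒ 𝐱.index x′) (sym e) (proj₂ (image x′))))

  -- Comparability and arithmetic of cardinals.

  comparable : (X Y : Set a) → ∣ X ∣ ≼ ∣ Y ∣ ⊎ ∣ Y ∣ ≼ ∣ X ∣
  comparable X Y with ≤-or-> (WellOrdering.length (zermelo X)) (WellOrdering.length (zermelo Y))
  ... | inj₁ le = inj₁ (initial-segment (zermelo X) (zermelo Y) le)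
  ... | inj₂ lt = inj₂ (initial-segment (zermelo Y) (zermelo X) (<⇒≤ lt))

  -- A predicate as a type whose elements are determined by their first
  -- component.
  Sub : {X : Set a} → Pred X b → Set a
  Sub {X = X} A = Σ X λ x → ⟦ A x ⟧ ≡ true

  Sub-≡ : {X : Set a} {A : Pred X b} {s t : Sub A} → proj₁ s ≡ proj₁ t → s ≡ t
  Sub-≡ {s = x , e} {.x , e′} refl = cong (x ,_) (irr e e′)
    where
    irr : ∀ {b : Bool} (e e′ : b ≡ true) → e ≡ e′
    irr refl refl = refl

  ⟪⟫≼Sub : {X : Set a} {A : Pred X b} → ⟪ A ⟫ ≼ ∣ Sub A ∣
  ⟪⟫≼Sub = record
    { to        = λ (x , h) → x , ⟦⟧-true h
    ; cong      = Sub-≡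
    ; injective = cong proj₁
    }

  Sub≼⟪⟫ : {X : Set a} {A : Pred X b} → ∣ Sub A ∣ ≼ ⟪ A ⟫
  Sub≼⟪⟫ = record
    { to        = λ (x , h) → x , ⟦⟧-true⁻¹ h
    ; cong      = cong proj₁
    ; injective = Sub-≡
    }

  -- Preimages are chosen on `Sub A`, hence from the element alone and not from the given proof of
  -- membership.
  covered-≼ : {X : Set a} {A : Pred X b} {Y : Set c} (g : Y → X) →
              (∀ {x} → A x → ∃ λ y → g y ≡ x) → ⟪ A ⟫ ≼ ∣ Y ∣
  covered-≼ {A = A} {Y} g cover = ≼-trans ⟪⟫≼Sub (mk↣ {to = to} injective)
    where
    to : Sub A → Y
    to (x , h) = proj₁ (cover (⟦⟧-true⁻¹ {P = A x} h))

    injective : Injective _≡_ _≡_ to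
    injective {x , h} {y , h′} e = Sub-≡ (trans (sym (proj₂ (cover (⟦⟧-true⁻¹ {P = A x} h))))
      (trans (cong g e) (proj₂ (cover (⟦⟧-true⁻¹ {P = A y} h′)))))

  ⟦≡⟧-injective : {X : Set a} {x y : X} → (∀ z → ⟦ x ≡ z ⟧ ≡ ⟦ y ≡ z ⟧) → x ≡ y
  ⟦≡⟧-injective {y = y} h = ⟦⟧-cong⁻¹ (sym (h y)) refl

  graph-injective : {X : Set a} {Y : Set b} {f g : X → Maybe Y} →
                    (∀ x y → ⟦ f x ≡ just y ⟧ ≡ ⟦ g x ≡ just y ⟧) → ∀ x → f x ≡ g x
  graph-injective {f = f} {g} h x with f x in eq | g x in eq′
  ... | nothing | nothing = refl
  ... | just y  | _       = trans (sym (⟦⟧-cong⁻¹ (h x y) eq)) eq′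
  ... | nothing | just y  = trans (sym eq) (⟦⟧-cong⁻¹ (sym (h x y)) eq′)

  -- The left summand goes to principal ultrafilters on `Z`, the right one to their complements; the
  -- whole of `Z` tells the two apart.
  ⊎-≼ : {X Y Z : Set c} → ∣ X ∣ ≼ ∣ Z ∣ → ∣ Y ∣ ≼ ∣ Z ∣ →
        ∣ X ⊎ Y ∣ ≼ ∣ ((Z → Bool) → Bool) ∣
  ⊎-≼ {X = X} {Y} {Z} i j = mk↣ {to = to} injective
    where
    module i = Injection i
    module j = Injection j

    to : X ⊎ Y → (Z → Bool) → Bool
    to (inj₁ x) S = S (i.to x)
    to (inj₂ y) S = not (S (j.to y))

    injective : Injective _≡_ _≡_ to
    injective {inj₁ x} {inj₁ x′} e =
      cong inj₁ (i.injective (⟦⟧-cong⁻¹ (cong-app e λ z → ⟦ i.to x ≡ z ⟧) refl))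
    injective {inj₂ y} {inj₂ y′} e =
      cong inj₂ (j.injective (⟦⟧-cong⁻¹ (not-injective (cong-app e λ z → ⟦ j.to y ≡ z ⟧)) refl))
    injective {inj₁ x} {inj₂ y} e with () ← cong-app e (λ _ → true)
    injective {inj₂ y} {inj₁ x} e with () ← cong-app e (λ _ → true)

  ×-≼ : {X : Set a} {Y : Set b} → ∣ X × Y ∣ ≼ ∣ (X ⊎ Y → Bool) ∣
  ×-≼ {X = X} {Y} = mk↣ {to = to} λ {p} {q} e → cong₂ _,_
      (⟦≡⟧-injective λ x → cong-app e (inj₁ x)) (⟦≡⟧-injective λ y → cong-app e (inj₂ y))
    where
    to : X × Y → X ⊎ Y → Bool
    to (x , _) (inj₁ x′) = ⟦ x ≡ x′ ⟧
    to (_ , y) (inj₂ y′) = ⟦ y ≡ y′ ⟧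

  →-≼ : {X : Set a} {Y : Set b} → ∣ (X → Y) ∣ ≼ ∣ (X × Y → Bool) ∣
  →-≼ = mk↣ {to = λ f (x , y) → ⟦ f x ≡ y ⟧} λ e →
    ext λ x → ⟦≡⟧-injective λ y → cong-app e (x , y)

  List-≼ : {X : Set a} → ∣ List X ∣ ≼ ∣ (ℕ × X → Bool) ∣
  List-≼ = mk↣ {to = λ xs (n , x) → ⟦ nth xs n ≡ just x ⟧} λ e →
    nth-injective (graph-injective λ n x → cong-app e (n , x))

  Vec-≼ : {X : Set a} {k : ℕ} → ∣ Vec X k ∣ ≼ ∣ List X ∣
  Vec-≼ = mk↣ {to = toList} λ {xs} {ys} e →
    trans (sym (Vecₚ.cast-is-id refl xs)) (Vecₚ.toList-injective refl xs ys e)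

  module StrongLimit {ℓ} {K : Set ℓ} (ℕ≺K : ∣ ℕ ∣ ≺ ∣ K ∣)
                     (powerset-small : (X : Set ℓ) → ∣ X ∣ ≺ ∣ K ∣ → ∣ (X → Bool) ∣ ≺ ∣ K ∣) where

    private variable
      X Y : Set ℓ

    ℕ-small : ∣ Lift ℓ ℕ ∣ ≺ ∣ K ∣
    ℕ-small = ≼-≺-trans (mk↣ {to = lower} (cong lift)) ℕ≺K

    -- Both summands are put into the larger one, whose double powerset then contains the sum.
    ⊎-small : ∣ X ∣ ≺ ∣ K ∣ → ∣ Y ∣ ≺ ∣ K ∣ → ∣ X ⊎ Y ∣ ≺ ∣ K ∣
    ⊎-small {X} {Y} sX sY with comparable X Y
    ... | inj₁ X≼Y = ≼-≺-trans (⊎-≼ X≼Y (mk↣ id)) (powerset-small _ (powerset-small _ sY))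
    ... | inj₂ Y≼X = ≼-≺-trans (⊎-≼ (mk↣ id) Y≼X) (powerset-small _ (powerset-small _ sX))

    ×-small : ∣ X ∣ ≺ ∣ K ∣ → ∣ Y ∣ ≺ ∣ K ∣ → ∣ X × Y ∣ ≺ ∣ K ∣
    ×-small sX sY = ≼-≺-trans ×-≼ (powerset-small _ (⊎-small sX sY))

    →-small : ∣ X ∣ ≺ ∣ K ∣ → ∣ Y ∣ ≺ ∣ K ∣ → ∣ (X → Y) ∣ ≺ ∣ K ∣
    →-small sX sY = ≼-≺-trans →-≼ (powerset-small _ (×-small sX sY))

    List-small : ∣ X ∣ ≺ ∣ K ∣ → ∣ List X ∣ ≺ ∣ K ∣
    List-small {X} sX = ≼-≺-trans (≼-trans List-≼ lift-ℕ) (powerset-small _ (×-small ℕ-small sX))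
      where
      lift-ℕ : ∣ (ℕ × X → Bool) ∣ ≼ ∣ (Lift ℓ ℕ × X → Bool) ∣
      lift-ℕ = mk↣ {to = λ S (lift n , x) → S (n , x)} λ e → ext λ (n , x) → cong-app e (lift n , x)

    Vec-small : ∀ {k} → ∣ X ∣ ≺ ∣ K ∣ → ∣ Vec X k ∣ ≺ ∣ K ∣
    Vec-small sX = ≼-≺-trans Vec-≼ (List-small sX)

  -- Infinite combinatorics: pigeonhole principle and Erdős-Rado theorem.

  pigeonhole : {X : Set a} {C : Set b} {Z : Set c} (f : X → C) →
               ¬ ∣ X ∣ ≼ ∣ C × Z ∣ → ∃ λ c → ¬ ⟪ (λ x → f x ≡ c) ⟫ ≼ ∣ Z ∣
  pigeonhole {X = X} {C} {Z} f large = choose λ none →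
    large (combine λ c → choose λ n → none (c , n))
    where
    combine : (∀ c → ⟪ (λ x → f x ≡ c) ⟫ ≼ ∣ Z ∣) → ∣ X ∣ ≼ ∣ C × Z ∣
    combine e = mk↣ {to = λ x → f x , e.to (f x) (x , refl)} λ e≡ →
      fibrewise (cong proj₁ e≡) (cong proj₂ e≡)
      where
      module e c = Injection (e c)

      fibrewise : ∀ {c d u v} → c ≡ d → e.to c u ≡ e.to d v → proj₁ u ≡ proj₁ v
      fibrewise {c} refl = e.injective c

  infinite : {X : Set a} {P : Pred X b} → ¬ ⟪ P ⟫ ≼ ∣ Lift a ℕ ∣ →
             ∃ λ (h : ℕ → X) → Injective _≡_ _≡_ h × (∀ n → P (h n))
  infinite {a = a} {P = P} large with comparable (Sub P) (Lift a ℕ)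
  ... | inj₁ i = contradiction (≼-trans ⟪⟫≼Sub i) large
  ... | inj₂ i = (λ n → proj₁ (i.to (lift n)))
               , (λ e → cong lower (i.injective (Sub-≡ e)))
               , (λ n → ⟦⟧-true⁻¹ (proj₂ (i.to (lift n))))
    where module i = Injection i

  module Sorting {X : Set a} (𝐱 : WellOrdering X) where
    open WellOrdering 𝐱

    -- The greatest entry comes first because tuples are always taken apart from the top, both for
    -- Erdős-Rado and in `mixed-clash`.
    Descending : ∀ {k} → Vec X k → Set a
    Descending = AllPairs (λ x y → y ⊏ x)

    insert : ∀ {k} → X → Vec X k → Vec X (suc k)
    insert x []       = x ∷ []
    insert x (y ∷ ys) with em {P = y ⊏ x}
    ... | yes _ = x ∷ y ∷ ys
    ... | no  _ = y ∷ insert x ys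

    sort : ∀ {k} → Vec X k → Vec X k
    sort []       = []
    sort (x ∷ xs) = insert x (sort xs)

    insert-All : {P : Pred X p} → ∀ {k x} {xs : Vec X k} →
                 P x → AllV.All P xs → AllV.All P (insert x xs)
    insert-All px [] = px ∷ []
    insert-All {x = x} {y ∷ _} px (py ∷ pys) with em {P = y ⊏ x}
    ... | yes _ = px ∷ py ∷ pys
    ... | no  _ = py ∷ insert-All px pys

    sort-All : {P : Pred X p} → ∀ {k} {xs : Vec X k} → AllV.All P xs → AllV.All P (sort xs)
    sort-All []         = []
    sort-All (px ∷ pxs) = insert-All px (sort-All pxs)

    insert-descending : ∀ {k x} {xs : Vec X k} → AllV.All (x ≢_) xs →
                        Descending xs → Descending (insert x xs)
    insert-descending [] [] = [] ∷ []
    insert-descending {x = x} {y ∷ _} (x≢y ∷ x∉ys) (ys⊏y ∷ d) with em {P = y ⊏ x}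
    ... | yes y⊏x = (y⊏x ∷ AllV.map (λ z⊏y → ⊏-trans z⊏y y⊏x) ys⊏y) ∷ ys⊏y ∷ d
    ... | no  y⊏̸x with ⊏-tri x y
    ...   | inj₁ x⊏y        = insert-All x⊏y ys⊏y ∷ insert-descending x∉ys d
    ...   | inj₂ (inj₁ x≡y) = contradiction x≡y x≢y
    ...   | inj₂ (inj₂ y⊏x) = contradiction y⊏x y⊏̸x

    sort-descending : ∀ {k} {xs : Vec X k} → Unique xs → Descending (sort xs)
    sort-descending []       = []
    sort-descending (x∉ ∷ u) = insert-descending (sort-All x∉) (sort-descending u)

  -- A subset of `Z`, a relation on it and a colouring of its `k`-tuples. The colouring is given by
  -- its graph, as tuples outside the subset have no colour.
  Code : Set a → ℕ → Set a → Set a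
  Code C k Z = (Z → Bool) × (Z → Z → Bool) × (Vec Z k → C → Bool)

  -- D y x says that y belongs to the canonical end-homogeneous set below
  -- x: the set D(x) of all y such that y and x give the same colour on
  -- top of any k elements of D(y).  It is recursive in y only.
  module EndHomogeneous {X C : Set a} (𝐱 : WellOrdering X) {k}
                        (f : Vec X (suc k) → C) (P : Pred X a) where
    open WellOrdering 𝐱

    private
      recursion : ∃ λ (D : X → X → Set a) → ∀ y → D y ≡ λ x →
        P y × y ⊏ x × (∀ zs → AllV.All (λ z → z ⊏ y × D z y) zs → f (y ∷ zs) ≡ f (x ∷ zs))
      recursion = wf-recursion ⊏-wellFounded λ y IH x →
        P y × y ⊏ x × (∀ zs → AllV.All (λ z → Σ (z ⊏ y) λ z⊏y → IH z⊏y y) zs →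
                          f (y ∷ zs) ≡ f (x ∷ zs))

    D : X → X → Set a
    D = proj₁ recursion

    D-eq : ∀ y x → D y x ≡ (P y × y ⊏ x ×
           (∀ zs → AllV.All (λ z → z ⊏ y × D z y) zs → f (y ∷ zs) ≡ f (x ∷ zs)))
    D-eq y x = cong-app (proj₂ recursion y) x

    D⇒⊏ : ∀ {y x} → D y x → y ⊏ x
    D⇒⊏ {y} {x} d = proj₁ (proj₂ (subst id (D-eq y x) d))

    D⇒P : ∀ {y x} → D y x → P y
    D⇒P {y} {x} d = proj₁ (subst id (D-eq y x) d)

    D-colour : ∀ {y x} → D y x → ∀ {zs} → AllV.All (λ z → D z y) zs → f (y ∷ zs) ≡ f (x ∷ zs)
    D-colour {y} {x} d h =
      proj₂ (proj₂ (subst id (D-eq y x) d)) _ (AllV.map (λ dz → D⇒⊏ dz , dz) h)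

    D-intro : ∀ {y x} → P y → y ⊏ x →
              (∀ {zs} → AllV.All (λ z → D z y) zs → f (y ∷ zs) ≡ f (x ∷ zs)) → D y x
    D-intro {y} {x} py y⊏x h =
      subst id (sym (D-eq y x)) (py , y⊏x , λ _ all → h (AllV.map proj₂ all))

    -- By induction on `z`: a tuple from D(z) also lies in D(y), so its colour is the same on top of
    -- `z`, of `y` and of `x`.
    D-trans : ∀ {z y x} → D z y → D y x → D z x
    D-trans {z} = go (⊏-wellFounded z)
      where
      go : ∀ {z y x} → Acc _⊏_ z → D z y → D y x → D z x
      go (acc rs) dzy dyx = D-intro (D⇒P dzy) (⊏-trans (D⇒⊏ dzy) (D⇒⊏ dyx)) λ h →
        trans (D-colour dzy h) (D-colour dyx (AllV.map (λ dw → go (rs (D⇒⊏ dw)) dw dzy) h))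

    -- On a tuple from D(z), both `z` and `y` give the colour that `x` gives; for `y` the induction
    -- first moves the tuple into D(y).
    D-linear : ∀ {z y x} → D z x → D y x → z ⊏ y → D z y
    D-linear {z} = go (⊏-wellFounded z)
      where
      go : ∀ {z y x} → Acc _⊏_ z → D z x → D y x → z ⊏ y → D z y
      go (acc rs) dzx dyx z⊏y = D-intro (D⇒P dzx) z⊏y λ h →
        trans (D-colour dzx h) (sym (D-colour dyx (AllV.map (λ dw →
          go (rs (D⇒⊏ dw)) (D-trans dw dzx) dyx (⊏-trans (D⇒⊏ dw) z⊏y)) h)))

    -- Otherwise the smaller of `x` and `x′` would belong to the set below the greater one, hence to
    -- the set below itself.
    D-determines : ∀ {x x′} → P x → P x′ → (∀ {z} → D z x → D z x′) → (∀ {z} → D z x′ → D z x) →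
                   (∀ {zs} → AllV.All (λ z → D z x) zs → f (x ∷ zs) ≡ f (x′ ∷ zs)) → x ≡ x′
    D-determines {x} {x′} px px′ sub sup col with ⊏-tri x x′
    ... | inj₁ x⊏x′        = contradiction (D⇒⊏ (sup (D-intro px x⊏x′ col))) ⊏-irrefl
    ... | inj₂ (inj₁ x≡x′) = x≡x′
    ... | inj₂ (inj₂ x′⊏x) = contradiction
      (D⇒⊏ (sub (D-intro px′ x′⊏x λ h → sym (col (AllV.map sup h))))) ⊏-irrefl

    -- If all sets D(x) embed into Z then x is coded by the order and the
    -- colouring that D(x) induces on Z.
    module Coding {Z : Set a} (e : ∀ {x} → P x → ⟪ (λ y → D y x) ⟫ ≼ ∣ Z ∣) where

      E : ∀ {x} → P x → X → Z → Set a
      E {x} px y i = Σ (D y x) λ d → Injection.to (e px) (y , d) ≡ i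

      E-total : ∀ {x y} (px : P x) → D y x → ∃ (E px y)
      E-total px d = _ , d , refl

      E-injective : ∀ {x y z i} (px : P x) → E px y i → E px z i → y ≡ z
      E-injective px (_ , refl) (_ , eq) = Injection.injective (e px) (sym eq)

      E-totals : ∀ {x n} {ys : Vec X n} (px : P x) → AllV.All (λ y → D y x) ys →
                 ∃ λ (v : Vec Z n) → Pointwise (E px) ys v
      E-totals px []       = [] , []
      E-totals px (d ∷ ds) = _ , (d , refl) ∷ proj₂ (E-totals px ds)

      E-injectives : ∀ {x n} {ys zs : Vec X n} {v : Vec Z n} (px : P x) →
                     Pointwise (E px) ys v → Pointwise (E px) zs v → ys ≡ zs
      E-injectives px []       []         = refl
      E-injectives px (h ∷ hs) (h′ ∷ hs′) = cong₂ _∷_ (E-injective px h h′) (E-injectives px hs hs′)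

      InDomain : ∀ {x} → P x → Z → Set a
      InDomain px i = ∃ λ y → E px y i

      Before : ∀ {x} → P x → Z → Z → Set a
      Before px i j = ∃ λ y → ∃ λ z → E px y i × E px z j × y ⊏ z

      Coloured : ∀ {x} → P x → Vec Z k → C → Set a
      Coloured {x} px v c = ∃ λ ys → Pointwise (E px) ys v × f (x ∷ ys) ≡ c

      code : ∃ P → Code C k Z
      code (x , px) =
        (λ i → ⟦ InDomain px i ⟧) , (λ i j → ⟦ Before px i j ⟧) , (λ v c → ⟦ Coloured px v c ⟧)

      module _ {x x′} (px : P x) (px′ : P x′)
               (dom : ∀ {i} → InDomain px i → InDomain px′ i)
               (bef : ∀ {i j} → Before px i j → Before px′ i j)
               (bef⁻¹ : ∀ {i j} → Before px′ i j → Before px i j)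
               (col : ∀ {v c} → Coloured px v c → Coloured px′ v c) where

        same-colour : ∀ {zs} {v : Vec Z k} → Pointwise (E px) zs v → Pointwise (E px′) zs v →
                      f (x ∷ zs) ≡ f (x′ ∷ zs)
        same-colour h h′ with col (_ , h , refl)
        ... | ys , h″ , eq with refl ← E-injectives px′ h″ h′ = sym eq

        -- By induction on `y`: let `y′` have the code `i` below `x′`. Then D(y) and D(y′) coincide
        -- with the same colours, and `D-determines` identifies `y` with `y′`.
        transfer : ∀ {y i} → Acc _⊏_ y → E px y i → E px′ y i
        transfer {y} {i} (acc rs) h@(dyx , _) with dom (y , h)
        ... | y′ , h′@(dy′x′ , _) = subst (λ u → E px′ u i) (sym y≡y′) h′
          where
          up : ∀ {z} → D z y → D z y′
          up {z} dzy =
            let hz  = proj₂ (E-total px (D-trans dzy dyx))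
                hz′ = transfer (rs (D⇒⊏ dzy)) hz
                (z₂ , y₂ , hz₂ , hy₂ , z₂⊏y₂) = bef (z , y , hz , h , D⇒⊏ dzy)
            in D-linear (proj₁ hz′) dy′x′
                 (subst₂ _⊏_ (E-injective px′ hz₂ hz′) (E-injective px′ hy₂ h′) z₂⊏y₂)

          -- Here `z` is not yet known to lie below `x`. The order pulls its code back to some `z₂`
          -- before `y`, and the induction hypothesis shows that `z₂` is `z`.
          down : ∀ {z} → D z y′ → D z y
          down {z} dzy′ =
            let hz′ = proj₂ (E-total px′ (D-trans dzy′ dy′x′))
                (z₂ , y₂ , hz₂ , hy₂ , z₂⊏y₂) = bef⁻¹ (z , y′ , hz′ , h′ , D⇒⊏ dzy′)
                z₂⊏y = subst (z₂ ⊏_) (E-injective px hy₂ h) z₂⊏y₂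
                z₂≡z = E-injective px′ (transfer (rs z₂⊏y) hz₂) hz′
            in subst (λ u → D u y) z₂≡z (D-linear (proj₁ hz₂) dyx z₂⊏y)

          transfers : ∀ {n} {zs : Vec X n} {v : Vec Z n} → AllV.All (λ z → D z y) zs →
                      Pointwise (E px) zs v → Pointwise (E px′) zs v
          transfers []       []       = []
          transfers (d ∷ ds) (z ∷ zs) = transfer (rs (D⇒⊏ d)) z ∷ transfers ds zs

          y≡y′ : y ≡ y′
          y≡y′ = D-determines (D⇒P dyx) (D⇒P dy′x′) up down λ ds →
            let hs = proj₂ (E-totals px (AllV.map (λ d → D-trans d dyx) ds))
            in trans (D-colour dyx ds) (trans (same-colour hs (transfers ds hs))
                 (sym (D-colour dy′x′ (AllV.map up ds))))

      code-injective : ⟪ P ⟫ ≼ ∣ Code C k Z ∣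
      code-injective = ≼-trans ⟪⟫≼Sub (mk↣ {to = λ (x , h) → code (x , ⟦⟧-true⁻¹ h)} λ {s} {t} →
        λ e → Sub-≡ (same-code (⟦⟧-true⁻¹ (proj₂ s)) (⟦⟧-true⁻¹ (proj₂ t)) e))
        where
        same-code : ∀ {x x′} (px : P x) (px′ : P x′) → code (x , px) ≡ code (x′ , px′) → x ≡ x′
        same-code px px′ e = D-determines px px′
          (λ d → proj₁ (to (proj₂ (E-total px d)))) (λ d → proj₁ (from (proj₂ (E-total px′ d))))
          λ ds → let hs = proj₂ (E-totals px ds) in
            same-colour px px′ dom bef bef⁻¹ col hs (Pointwise.map to hs)
          where
          dom : ∀ {i} → InDomain px i → InDomain px′ i
          dom {i} = ⟦⟧-cong⁻¹ (cong-app (cong proj₁ e) i)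
          dom⁻¹ : ∀ {i} → InDomain px′ i → InDomain px i
          dom⁻¹ {i} = ⟦⟧-cong⁻¹ (sym (cong-app (cong proj₁ e) i))
          bef : ∀ {i j} → Before px i j → Before px′ i j
          bef {i} {j} = ⟦⟧-cong⁻¹ (cong (λ c → proj₁ (proj₂ c) i j) e)
          bef⁻¹ : ∀ {i j} → Before px′ i j → Before px i j
          bef⁻¹ {i} {j} = ⟦⟧-cong⁻¹ (sym (cong (λ c → proj₁ (proj₂ c) i j) e))
          col : ∀ {v c} → Coloured px v c → Coloured px′ v c
          col {v} {c} = ⟦⟧-cong⁻¹ (cong (λ d → proj₂ (proj₂ d) v c) e)
          col⁻¹ : ∀ {v c} → Coloured px′ v c → Coloured px v c
          col⁻¹ {v} {c} = ⟦⟧-cong⁻¹ (sym (cong (λ d → proj₂ (proj₂ d) v c) e))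
          to : ∀ {y i} → E px y i → E px′ y i
          to = transfer px px′ dom bef bef⁻¹ col (⊏-wellFounded _)
          from : ∀ {y i} → E px′ y i → E px y i
          from = transfer px′ px dom⁻¹ bef⁻¹ bef col⁻¹ (⊏-wellFounded _)

  -- Each value counts the codes over the previous one, so a set exceeding it has some D(x)
  -- exceeding the previous value.
  ErdősRadoBound : Set a → ℕ → Set a
  ErdősRadoBound {a} C zero    = Lift a ℕ
  ErdősRadoBound     C (suc k) = Code C k (ErdősRadoBound C k)

  module _ {X C : Set a} (𝐱 : WellOrdering X) where
    open Sorting 𝐱

    -- By `code-injective` some D(x) is too large for the previous bound. On descending tuples from
    -- D(x) the first entry may be replaced by `x` without changing the colour, so the induction
    -- applies to the colouring `f ∘ (x ∷_)`.
    erdős-rado : ∀ k (f : Vec X k → C) (P : Pred X a) → ¬ ⟪ P ⟫ ≼ ∣ ErdősRadoBound C k ∣ →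
      ∃ λ (H : Pred X a) → (∀ {x} → H x → P x) × ¬ ⟪ H ⟫ ≼ ∣ Lift a ℕ ∣ ×
      ∃ λ c → ∀ {v} → Descending v → AllV.All H v → f v ≡ c
    erdős-rado zero    f P large = P , id , large , f [] , λ { [] [] → refl }
    erdős-rado (suc k) f P large =
      let (x , px , Dx-large) = large-D
          (H , H⊆D , H-large , c , homogeneous) = erdős-rado k (f ∘ (x ∷_)) (λ y → D y x) Dx-large
      in H , D⇒P ∘ H⊆D , H-large , c , λ where
           (zs⊏y ∷ desc) (hy ∷ hzs) →
             trans (D-colour (H⊆D hy) (AllV.map (λ (z⊏y , hz) → D-linear (H⊆D hz) (H⊆D hy) z⊏y)
                                                (AllV.zip (zs⊏y , hzs))))
                   (homogeneous desc hzs)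
      where
      open EndHomogeneous 𝐱 f P

      large-D : ∃ λ x → P x × ¬ ⟪ (λ y → D y x) ⟫ ≼ ∣ ErdősRadoBound C k ∣
      large-D = choose λ none →
        large (Coding.code-injective λ {x} px → choose λ n → none (x , px , n))

  -- A nonprincipal ultrafilter on ℕ: running through a well-ordering of the
  -- powerset, a set is accepted as long as its intersections with finitely
  -- many sets accepted before are infinite.
  module Ultrafilter where
    open WellOrdering (zermelo (ℕ → Bool)) using (_⊏_; ⊏-wellFounded; ⊏-tri; ⊏-trans)

    InfiniteMeet : List (ℕ → Bool) → Set
    InfiniteMeet Ss =
      ∀ {n} (w : Vec ℕ n) → ∃ λ i → AllV.All (i ≢_) w × AllL.All (λ S → S i ≡ true) Ss

    private
      recursion : ∃ λ (U : (ℕ → Bool) → Set) → ∀ S → U S ≡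
        (∀ Ss → AllL.All (λ S′ → S′ ⊏ S × U S′) Ss → InfiniteMeet (S ∷ Ss))
      recursion = wf-recursion ⊏-wellFounded λ S IH →
        ∀ Ss → AllL.All (λ S′ → Σ (S′ ⊏ S) λ S′⊏S → IH S′⊏S) Ss → InfiniteMeet (S ∷ Ss)

    U : (ℕ → Bool) → Set
    U = proj₁ recursion

    U-unfold : ∀ S → U S ≡ (∀ Ss → AllL.All (λ S′ → S′ ⊏ S × U S′) Ss → InfiniteMeet (S ∷ Ss))
    U-unfold = proj₂ recursion

    -- The condition that defines `U` at a set speaks of earlier sets only, so a finite family is
    -- rearranged with its latest member in front.
    U-greatest : ∀ {S Ss} → U S → AllL.All U Ss → ∃ λ S′ → ∃ λ Ss′ →
      U S′ × AllL.All (λ S″ → S″ ⊏ S′ × U S″) Ss′ ×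
      (∀ {i} → AllL.All (λ S → S i ≡ true) (S′ ∷ Ss′) → AllL.All (λ S → S i ≡ true) (S ∷ Ss))
    U-greatest {S} u [] = S , [] , u , [] , id
    U-greatest {S} u (u₁ ∷ us) with U-greatest u₁ us
    ... | S′ , Ss′ , u′ , us′ , sub with ⊏-tri S S′
    ...   | inj₁ S⊏S′ = S′ , S ∷ Ss′ , u′ , (S⊏S′ , u) ∷ us′ , λ { (h′ ∷ h ∷ hs) → h ∷ sub (h′ ∷ hs) }
    ...   | inj₂ (inj₁ refl) = S′ , Ss′ , u′ , us′ , λ { hs@(h ∷ _) → h ∷ sub hs }
    ...   | inj₂ (inj₂ S′⊏S) = S , S′ ∷ Ss′ , u
        , (S′⊏S , u′) ∷ AllL.map (λ (S″⊏S′ , u″) → ⊏-trans S″⊏S′ S′⊏S , u″) us′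
        , λ { (h ∷ hs) → h ∷ sub hs }

    U-infiniteMeet : ∀ {Ss} → AllL.All U Ss → InfiniteMeet Ss
    U-infiniteMeet [] w = let (i , i∉w) = fresh w in i , i∉w , []
    U-infiniteMeet (u ∷ us) w =
      let (S′ , Ss′ , u′ , us′ , sub) = U-greatest u us
          (i , i∉w , hs) = subst id (U-unfold S′) u′ Ss′ us′ w
      in i , i∉w , sub hs

    U-rejected : ∀ {S} → ¬ U S → ∃ λ Ss → AllL.All U Ss × ∃ λ n → ∃ λ (w : Vec ℕ n) →
      ∀ {i} → AllV.All (i ≢_) w → AllL.All (λ S → S i ≡ true) Ss → S i ≢ true
    U-rejected {S} ¬u = choose λ none → ¬u (subst id (sym (U-unfold S)) λ Ss us {n} w →
      choose λ no → none (Ss , AllL.map proj₂ us , n , w , λ {i} i∉w hs h → no (i , i∉w , h ∷ hs)))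

    -- If both were rejected, pooling the accepted sets and the finite exceptions that block them
    -- would give an `i` in neither `S` nor its complement.
    U-complement : ∀ S → U S ⊎ U (not ∘ S)
    U-complement S = choose λ none →
      let (Ss , us , _ , w , out) = U-rejected (none ∘ inj₁)
          (Ss′ , us′ , _ , w′ , out′) = U-rejected (none ∘ inj₂)
          (i , i∉ , hs) = U-infiniteMeet (Allₚ.++⁺ us us′) (w Vec.++ w′)
          one = out (AllVₚ.++ˡ⁻ w i∉) (Allₚ.++⁻ˡ Ss hs)
          two = out′ (AllVₚ.++ʳ⁻ w i∉) (Allₚ.++⁻ʳ Ss hs)
      in impossible (S i) one two
      where
      impossible : ∀ b {A : Set} → b ≢ true → not b ≢ true → A
      impossible true  h _ = contradiction refl h
      impossible false _ h = contradiction refl h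

    Eventually : Pred ℕ a → Set
    Eventually P = U (λ i → ⟦ P i ⟧)

    -- `Q` replaces the negation of `P` because `Sat (neg φ)` maps into a polymorphic empty type and
    -- is only equivalent to the negation of `Sat φ`.
    eventually-split : {P Q : Pred ℕ a} → (∀ {i} → ¬ P i → Q i) → (∀ {i} → Q i → ¬ P i) →
                       Eventually P ⊎ Eventually Q
    eventually-split {P = P} {Q} ¬P⇒Q Q⇒¬P with U-complement (λ i → ⟦ P i ⟧)
    ... | inj₁ u = inj₁ u
    ... | inj₂ u = inj₂ (subst U (ext complement) u)
      where
      complement : ∀ i → not ⟦ P i ⟧ ≡ ⟦ Q i ⟧
      complement i with em {P = P i} | em {P = Q i}
      ... | yes p | yes q = contradiction p (Q⇒¬P q)
      ... | yes p | no ¬q = refl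
      ... | no ¬p | yes q = refl
      ... | no ¬p | no ¬q = contradiction (¬P⇒Q ¬p) ¬q

    eventually-all : {Y : Set b} {P : Y → Pred ℕ a} {ys : List Y} →
      AllL.All (λ y → Eventually (P y)) ys → (w : Vec ℕ n) →
      ∃ λ i → AllV.All (i ≢_) w × AllL.All (λ y → P y i) ys
    eventually-all h w =
      let (i , i∉w , hs) = U-infiniteMeet (Allₚ.map⁺ h) w
      in i , i∉w , AllL.map ⟦⟧-true⁻¹ (Allₚ.map⁻ hs)

    eventually-some : {P : Pred ℕ a} → Eventually P → (w : Vec ℕ n) →
                      ∃ λ i → AllV.All (i ≢_) w × P i
    eventually-some u w =
      let (i , i∉w , h) = U-infiniteMeet (u ∷ []) w in i , i∉w , ⟦⟧-true⁻¹ (AllL.head h)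

-- Syntax: renaming, definable connectives, counting of formulas.

open Equivalence using (to; from)

module _ (n : ℕ) {m : ℕ} (f : Fin n → Fin n′) (g : Fin m → Fin n′) where

  reindex : Fin (n + m) → Fin n′
  reindex i = [ f , g ]′ (splitAt n i)

  lookup-reindex : {X : Set a} (c : Vec X n) (u : Vec X m) (v : Vec X n′) →
                   (∀ i → lookup v (f i) ≡ lookup c i) → (∀ j → lookup v (g j) ≡ lookup u j) →
                   ∀ i → lookup v (reindex i) ≡ lookup (c ++ u) i
  lookup-reindex c u v hf hg i = trans (split (splitAt n i)) (sym (Vecₚ.lookup-splitAt n c u i))
    where
    split : ∀ s → lookup v ([ f , g ]′ s) ≡ [ lookup c , lookup u ]′ s
    split (inj₁ i) = hf i
    split (inj₂ j) = hg j

firstOf : ∀ n m l → Fin (n + m) → Fin (n + (m + l))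
firstOf n m l = reindex n {m = m} (_↑ˡ (m + l)) (λ i → n ↑ʳ (i ↑ˡ l))

secondOf : ∀ n m l → Fin (n + l) → Fin (n + (m + l))
secondOf n m l = reindex n {m = l} (_↑ˡ (m + l)) (λ j → n ↑ʳ (m ↑ʳ j))

outerOf : ∀ n m l → Fin (n + l) → Fin ((n + m) + l)
outerOf n m l = reindex n {m = l} (λ i → (i ↑ˡ m) ↑ˡ l) ((n + m) ↑ʳ_)

-- The entries of a vector over Y ⊎ Fin m are those of a tuple of length m
-- followed by parameters from Y.
separate : {Y : Set a} (i : Vec (Y ⊎ Fin m) l) →
           ∃ λ l′ → Σ (Vec Y l′) λ u → Σ (Fin l → Fin (m + l′)) λ σ →
           ∀ {X : Set b} (g : Y → X) (c : Vec X m) j →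
           lookup (c ++ Vec.map g u) (σ j) ≡ [ g , lookup c ]′ (lookup i j)
separate [] = 0 , [] , (λ ()) , λ _ _ ()
separate {m = m} (inj₂ t ∷ i) =
  let (l′ , u , σ , eq) = separate i in
  l′ , u , (λ { zero → t ↑ˡ l′ ; (suc j) → σ j }) , λ where
    g c zero    → Vecₚ.lookup-++ˡ c (Vec.map g u) t
    g c (suc j) → eq g c j
separate {m = m} (inj₁ y ∷ i) =
  let (l′ , u , σ , eq) = separate i
      shift = reindex m {m = l′} (_↑ˡ suc l′) (λ j → m ↑ʳ suc j)
  in suc l′ , y ∷ u , (λ { zero → m ↑ʳ zero ; (suc j) → shift (σ j) }) , λ where
    g c zero    → Vecₚ.lookup-++ʳ c (g y ∷ Vec.map g u) zero
    g c (suc j) → trans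
      (lookup-reindex m {m = l′} _ _ c (Vec.map g u) (c ++ g y ∷ Vec.map g u)
        (Vecₚ.lookup-++ˡ c _) (λ t → Vecₚ.lookup-++ʳ c _ (suc t)) (σ j))
      (eq g c j)

module _ {L : Language ℓ} where

  mutual
    renᵗ : (Fin m → Fin n) → Term L m → Term L n
    renᵗ σ (var i)    = var (σ i)
    renᵗ σ (fun f ts) = fun f (renᵗˢ σ ts)

    renᵗˢ : (Fin m → Fin n) → Vec (Term L m) k → Vec (Term L n) k
    renᵗˢ σ []       = []
    renᵗˢ σ (t ∷ ts) = renᵗ σ t ∷ renᵗˢ σ ts

  ren : (Fin m → Fin n) → Formula L m → Formula L n
  ren σ (s ≐ t)    = renᵗ σ s ≐ renᵗ σ t
  ren σ (rel r ts) = rel r (renᵗˢ σ ts)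
  ren σ bot        = bot
  ren σ (φ ⇒ ψ)    = ren σ φ ⇒ ren σ ψ
  ren σ (all φ)    = all (ren (Fin.lift 1 σ) φ)

  and : Formula L n → Formula L n → Formula L n
  and φ ψ = neg (φ ⇒ neg ψ)

  ex : Formula L (suc n) → Formula L n
  ex φ = neg (all (neg φ))

  exs : ∀ n → Formula L ((n + m) + l) → Formula L (m + l)
  exs zero    φ = φ
  exs (suc n) φ = exs n (ex φ)

  -- φ(x; u) ∧ ψ(x; v) with parameters u ++ v
  joint : ∀ n m l → Formula L (n + m) → Formula L (n + l) → Formula L (n + (m + l))
  joint n m l φ ψ = and (ren (firstOf n m l) φ) (ren (secondOf n m l) ψ)

  -- ∃ x. φ(x, y) ∧ ψ(x; u) as a formula in y with parameters u
  meet : ∀ n m l → Formula L (n + m) → Formula L (n + l) → Formula L (m + l)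
  meet n m l φ ψ = exs n (and (ren (_↑ˡ l) φ) (ren (outerOf n m l) ψ))

  -- A formula whose parameters are names from `Y`. Different assignments of elements to names yield
  -- comparable instances of one formula.
  Template : Set a → ℕ → Set (ℓ ⊔ a)
  Template Y n = ∃ λ m → Formula L (n + m) × Vec Y m

  ⋀ : {Y : Set a} → List (Template Y n) → Template Y n
  ⋀ []                  = 0 , neg bot , []
  ⋀ {n = n} ((_ , φ , u) ∷ ts) = let (_ , ψ , v) = ⋀ ts in _ , joint n _ _ φ ψ , u ++ v

  module _ {M : Structure L} where
    open Structure M

    mutual
      eval-ren : (σ : Fin m → Fin n) {ρ : Vec Carrier n} {ρ′ : Vec Carrier m} →
                 (∀ i → lookup ρ (σ i) ≡ lookup ρ′ i) → ∀ t →
                 eval M (renᵗ σ t) ρ ≡ eval M t ρ′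
      eval-ren σ h (var i)    = h i
      eval-ren σ h (fun f ts) = cong (funᴵ f) (evals-ren σ h ts)

      evals-ren : (σ : Fin m → Fin n) {ρ : Vec Carrier n} {ρ′ : Vec Carrier m} →
                  (∀ i → lookup ρ (σ i) ≡ lookup ρ′ i) → (ts : Vec (Term L m) k) →
                  evals M (renᵗˢ σ ts) ρ ≡ evals M ts ρ′
      evals-ren σ h []       = refl
      evals-ren σ h (t ∷ ts) = cong₂ _∷_ (eval-ren σ h t) (evals-ren σ h ts)

    Sat-ren : (σ : Fin m → Fin n) (φ : Formula L m) {ρ : Vec Carrier n} {ρ′ : Vec Carrier m} →
              (∀ i → lookup ρ (σ i) ≡ lookup ρ′ i) → Sat M (ren σ φ) ρ ⇔ Sat M φ ρ′
    Sat-ren σ (s ≐ t) {ρ} {ρ′} h rewrite eval-ren σ {ρ} {ρ′} h s | eval-ren σ {ρ} {ρ′} h t = mk⇔ id id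
    Sat-ren σ (rel r ts) {ρ} {ρ′} h rewrite evals-ren σ {ρ} {ρ′} h ts = mk⇔ id id
    Sat-ren σ bot h = mk⇔ id id
    Sat-ren σ (φ ⇒ ψ) h = mk⇔
      (λ s → to (Sat-ren σ ψ h) ∘ s ∘ from (Sat-ren σ φ h))
      (λ s → from (Sat-ren σ ψ h) ∘ s ∘ to (Sat-ren σ φ h))
    Sat-ren σ (all φ) h = mk⇔
      (λ s x → to (Sat-ren (Fin.lift 1 σ) φ (ext x)) (s x))
      (λ s x → from (Sat-ren (Fin.lift 1 σ) φ (ext x)) (s x))
      where
      ext : ∀ x i → lookup (x ∷ _) (Fin.lift 1 σ i) ≡ lookup (x ∷ _) i
      ext x zero    = refl
      ext x (suc i) = h i

    inst : {Y : Set a} → (Y → Carrier) → Template Y n → PFormula M n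
    inst b (_ , φ , u) = φ ⟨ Vec.map b u ⟩

    module Semantics (em : ∀ {a} → ExcludedMiddle a) where

      Sat-neg : (φ : Formula L n) {ρ : Vec Carrier n} → ¬ Sat M φ ρ → Sat M (neg φ) ρ
      Sat-neg φ h s = contradiction s h

      Sat-neg⁻¹ : (φ : Formula L n) {ρ : Vec Carrier n} → Sat M (neg φ) ρ → ¬ Sat M φ ρ
      Sat-neg⁻¹ φ h s = ⊥-elim (h s)

      Sat-and : (φ ψ : Formula L n) {ρ : Vec Carrier n} →
                Sat M (and φ ψ) ρ ⇔ (Sat M φ ρ × Sat M ψ ρ)
      Sat-and φ ψ = mk⇔
        (λ h → decidable-stable em λ n → ⊥-elim (h λ s → Sat-neg ψ λ t → n (s , t)))
        (λ (s , t) h → h s t)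

      Sat-ex : (φ : Formula L (suc n)) {ρ : Vec Carrier n} →
               Sat M (ex φ) ρ ⇔ ∃ λ x → Sat M φ (x ∷ ρ)
      Sat-ex φ = mk⇔
        (λ h → decidable-stable em λ n → ⊥-elim (h λ x → Sat-neg φ λ s → n (x , s)))
        (λ (x , s) h → h x s)

      Sat-exs : ∀ n (φ : Formula L ((n + m) + l)) {y : Vec Carrier m} {u : Vec Carrier l} →
                Sat M (exs n φ) (y ++ u) ⇔ ∃ λ c → Sat M φ ((c ++ y) ++ u)
      Sat-exs zero    φ = mk⇔ (λ s → [] , s) λ { ([] , s) → s }
      Sat-exs (suc n) φ = mk⇔
        (λ s → let (c , s′) = to (Sat-exs n (ex φ)) s
                   (x , s″) = to (Sat-ex φ) s′ in x ∷ c , s″)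
        (λ { (x ∷ c , s) → from (Sat-exs n (ex φ)) (c , from (Sat-ex φ) (x , s)) })

      Sat-joint : ∀ n m l (φ : Formula L (n + m)) (ψ : Formula L (n + l))
                  {c : Vec Carrier n} {u : Vec Carrier m} {v : Vec Carrier l} →
                  Sat M (joint n m l φ ψ) (c ++ (u ++ v)) ⇔ (Sat M φ (c ++ u) × Sat M ψ (c ++ v))
      Sat-joint n m l φ ψ {c} {u} {v} = mk⇔
        (λ s → let (s₁ , s₂) = to both s in to left s₁ , to right s₂)
        (λ (s₁ , s₂) → from both (from left s₁ , from right s₂))
        where
        both  = Sat-and (ren (firstOf n m l) φ) (ren (secondOf n m l) ψ) {c ++ (u ++ v)}
        left  = Sat-ren (firstOf n m l) φ (lookup-reindex n {m = m} _ _ c u (c ++ (u ++ v))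
          (Vecₚ.lookup-++ˡ c _)
          λ i → trans (Vecₚ.lookup-++ʳ c _ (i ↑ˡ l)) (Vecₚ.lookup-++ˡ u v i))
        right = Sat-ren (secondOf n m l) ψ (lookup-reindex n {m = l} _ _ c v (c ++ (u ++ v))
          (Vecₚ.lookup-++ˡ c _)
          λ j → trans (Vecₚ.lookup-++ʳ c _ (m ↑ʳ j)) (Vecₚ.lookup-++ʳ u v j))

      Sat-meet : ∀ n m l (φ : Formula L (n + m)) (ψ : Formula L (n + l))
                 {y : Vec Carrier m} {u : Vec Carrier l} →
                 Sat M (meet n m l φ ψ) (y ++ u) ⇔ ∃ λ c → Sat M φ (c ++ y) × Sat M ψ (c ++ u)
      Sat-meet n m l φ ψ {y} {u} = mk⇔
        (λ s → let (c , s′) = to some s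
                   (s₁ , s₂) = to (both c) s′ in c , to (left c) s₁ , to (right c) s₂)
        (λ (c , s₁ , s₂) → from some (c , from (both c) (from (left c) s₁ , from (right c) s₂)))
        where
        φ′ = ren (_↑ˡ l) φ
        ψ′ = ren (outerOf n m l) ψ
        some  = Sat-exs n (and φ′ ψ′) {y} {u}
        both  = λ c → Sat-and φ′ ψ′ {(c ++ y) ++ u}
        left  = λ c → Sat-ren (_↑ˡ l) φ (Vecₚ.lookup-++ˡ (c ++ y) u)
        right = λ c → Sat-ren (outerOf n m l) ψ (lookup-reindex n {m = l} _ _ c u ((c ++ y) ++ u)
          (λ i → trans (Vecₚ.lookup-++ˡ (c ++ y) u (i ↑ˡ m)) (Vecₚ.lookup-++ˡ c y i))
          (Vecₚ.lookup-++ʳ (c ++ y) u))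

      ⊨-⋀ : {Y : Set a} (b : Y → Carrier) {c : Vec Carrier n} (ts : List (Template Y n)) →
            _⊨_ M c (inst b (⋀ ts)) ⇔ AllL.All (λ t → _⊨_ M c (inst b t)) ts
      ⊨-⋀ b [] = mk⇔ (λ _ → []) (λ _ s → s)
      ⊨-⋀ {n = n} b {c} ts′@((m , φ , u) ∷ ts) =
        let (l , ψ , v) = ⋀ ts
            eq = Sat-joint n m l φ ψ {c}
        in subst (λ w → Sat M (joint n m l φ ψ) (c ++ w) ⇔
                        AllL.All (λ t → _⊨_ M c (inst b t)) ts′)
          (sym (Vecₚ.map-++ b u v))
          (mk⇔ (λ s → let (s₁ , s₂) = to eq s in s₁ ∷ to (⊨-⋀ b ts) s₂)
               (λ { (s₁ ∷ s₂) → from eq (s₁ , from (⊨-⋀ b ts) s₂) }))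

  ⋀-params : {Y : Set a} {P : Pred Y b} {ts : List (Template Y n)} →
             AllL.All (λ t → AllV.All P (proj₂ (proj₂ t))) ts →
             AllV.All P (proj₂ (proj₂ (⋀ ts)))
  ⋀-params []       = AllV.[]
  ⋀-params (h ∷ hs) = AllVₚ.++⁺ h (⋀-params hs)

  -- Formulas are counted through their Polish notation.  The leading token
  -- is kept apart so that its equation alone decides the constructor.
  Token : Set ℓ
  Token = Lift ℓ ℕ ⊎ Language.Symbol L

  headᵗ : Term L n → Token
  headᵗ (var i)       = inj₁ (lift (toℕ i))
  headᵗ (fun {k} f _) = inj₂ (inj₁ (k , f))

  mutual
    bodyᵗ : Term L n → List Token → List Token
    bodyᵗ (var _)    xs = xs
    bodyᵗ (fun _ ts) xs = polishᵗˢ ts xs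

    polishᵗˢ : Vec (Term L n) k → List Token → List Token
    polishᵗˢ []       xs = xs
    polishᵗˢ (t ∷ ts) xs = headᵗ t ∷ bodyᵗ t (polishᵗˢ ts xs)

  -- Numerals also encode variables in `headᵗ`. No clash arises, as heads of formulas are compared
  -- only with heads of formulas.
  head : Formula L n → Token
  head (_ ≐ _)       = inj₁ (lift 0)
  head bot           = inj₁ (lift 1)
  head (_ ⇒ _)       = inj₁ (lift 2)
  head (all _)       = inj₁ (lift 3)
  head (rel {k} r _) = inj₂ (inj₂ (k , r))

  body : Formula L n → List Token → List Token
  body (s ≐ t)    xs = polishᵗˢ (s ∷ t ∷ []) xs
  body bot        xs = xs
  body (φ ⇒ ψ)    xs = head φ ∷ body φ (head ψ ∷ body ψ xs)
  body (all φ)    xs = head φ ∷ body φ xs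
  body (rel _ ts) xs = polishᵗˢ ts xs

  mutual
    -- The tokens that follow are carried along, so that the induction also finds where the term
    -- ends.
    polishᵗ-injective : (s t : Term L n) {xs ys : List Token} → headᵗ s ≡ headᵗ t →
                        bodyᵗ s xs ≡ bodyᵗ t ys → s ≡ t × xs ≡ ys
    polishᵗ-injective (var _)    (var _)     h e = cong var (toℕ-injective (cong lower (inj₁-injective h))) , e
    polishᵗ-injective (fun f ts) (fun g us) refl e =
      let (ts≡us , e′) = polishᵗˢ-injective ts us e in cong (fun f) ts≡us , e′

    polishᵗˢ-injective : (ss ts : Vec (Term L n) k) {xs ys : List Token} →
                         polishᵗˢ ss xs ≡ polishᵗˢ ts ys → ss ≡ ts × xs ≡ ys
    polishᵗˢ-injective []       []       e = refl , e
    polishᵗˢ-injective (s ∷ ss) (t ∷ ts) e =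
      let (h , e₁)  = ∷-injective e
          (s≡t , e₂) = polishᵗ-injective s t h e₁
          (ss≡ts , e₃) = polishᵗˢ-injective ss ts e₂
      in cong₂ _∷_ s≡t ss≡ts , e₃

  polish-injective : (φ ψ : Formula L n) {xs ys : List Token} → head φ ≡ head ψ →
                     body φ xs ≡ body ψ ys → φ ≡ ψ × xs ≡ ys
  polish-injective (s ≐ t) (s′ ≐ t′) refl e
    with refl , e′ ← polishᵗˢ-injective (s ∷ t ∷ []) (s′ ∷ t′ ∷ []) e = refl , e′
  polish-injective bot bot refl e = refl , e
  polish-injective (φ ⇒ ψ) (φ′ ⇒ ψ′) refl e =
    let (h₁ , e₁) = ∷-injective e
        (φ≡φ′ , e₂) = polish-injective φ φ′ h₁ e₁
        (h₃ , e₃) = ∷-injective e₂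
        (ψ≡ψ′ , e₄) = polish-injective ψ ψ′ h₃ e₃
    in cong₂ _⇒_ φ≡φ′ ψ≡ψ′ , e₄
  polish-injective (all φ) (all φ′) refl e =
    let (h₁ , e₁) = ∷-injective e
        (φ≡φ′ , e₂) = polish-injective φ φ′ h₁ e₁
    in cong all φ≡φ′ , e₂
  polish-injective (rel r ts) (rel .r us) refl e =
    let (ts≡us , e′) = polishᵗˢ-injective ts us e in cong (rel r) ts≡us , e′

  Formula≼Tokens : ∣ Formula L n ∣ ≼ ∣ List Token ∣
  Formula≼Tokens = mk↣ {to = λ φ → head φ ∷ body φ []} λ {φ} {ψ} e →
    let (h , e′) = ∷-injective e in proj₁ (polish-injective φ ψ h e′)

  Template≼ : {Y : Set a} → ∣ Template Y n ∣ ≼ ∣ Lift ℓ ℕ × List Token × List Y ∣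
  Template≼ {n = n} {Y} = mk↣ {to = code} injective
    where
    code : Template Y n → Lift ℓ ℕ × List Token × List Y
    code (m , φ , u) = lift m , head φ ∷ body φ [] , toList u

    injective : Injective _≡_ _≡_ code
    injective {m , φ , u} {m′ , ψ , v} e with refl ← cong (lower ∘ proj₁) e =
      cong₂ (λ φ u → m , φ , u)
        (Injection.injective Formula≼Tokens (cong (proj₁ ∘ proj₂) e))
        (trans (sym (Vecₚ.cast-is-id refl u)) (Vecₚ.toList-injective refl u v (cong (proj₂ ∘ proj₂) e)))

-- Counting types and templates in the monster model.

module Monster (em : ∀ {a} → ExcludedMiddle a) (ext : ∀ {a b} → Extensionality a b)
               {ℓ} {L : Language ℓ} {T : Theory L} {K : Set ℓ}
               (K-large : SufficientlyLarge L K) (𝕮 : MonsterModel T K) where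
  open Ordinals em
  open Classical em ext
  open Ultrafilter using (Eventually; eventually-split; eventually-all; eventually-some)
  open SufficientlyLarge K-large
  open StrongLimit uncountable strongLimit
  open Ranks 𝕮
  open MonsterModel 𝕮 renaming (structure to M)
  open Structure M
  open Semantics {L = L} {M} em
  open CompleteType
  open PFormula

  Template-small : {Y : Set ℓ} → ∣ Y ∣ ≺ ∣ K ∣ → ∣ Template {L = L} Y n ∣ ≺ ∣ K ∣
  Template-small Y≺K = ≼-≺-trans Template≼
    (×-small ℕ-small (×-small (List-small (⊎-small ℕ-small language<κ̄)) (List-small Y≺K)))

  Sub-dom-small : (p : Type n) → ∣ Sub (dom p) ∣ ≺ ∣ K ∣
  Sub-dom-small p = ≼-≺-trans Sub≼⟪⟫ (small p)

  -- Types live in `Set (lsuc ℓ)` and are compared by `≋`; their codes live in `Set ℓ` and are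
  -- compared by equality.
  code : Type n → PFormula M n → Bool
  code q θ = ⟦ formulas q θ ⟧

  code⇒≋ : (q r : Type n) → code q ≡ code r → q ≋ r
  code⇒≋ q r e = (λ {θ} → ⟦⟧-cong⁻¹ (cong-app e θ)) , (λ {θ} → ⟦⟧-cong⁻¹ (sym (cong-app e θ)))

  ≋⇒code : (q r : Type n) → q ≋ r → code q ≡ code r
  ≋⇒code q r (q⊑r , r⊑q) = ext λ θ → ⟦⟧-cong q⊑r r⊑q

  Fin-small : ∣ Lift ℓ (Fin m) ∣ ≺ ∣ K ∣
  Fin-small = ≼-≺-trans
    (mk↣ {to = λ i → lift {ℓ = ℓ} (toℕ (lower i))}
      λ e → cong lift (toℕ-injective (cong lower e)))
    ℕ-small

  -- Average types and the stretching of sequences.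

  module _ (bs : ℕ → Vec Carrier m) where

    -- Finitely many formulas of the ultrafilter average hold at a common `bs i`; completeness is
    -- the ultrafilter property.
    averageType : (B : Pred Carrier ℓ) → Small M K B → Type m
    averageType B B-small = record
      { dom        = B
      ; formulas   = λ θ → AllV.All B (params θ) × Lift ℓ (Eventually λ i → _⊨_ M (bs i) θ)
      ; small      = B-small
      ; over       = proj₁
      ; consistent = λ Δ h →
          let (i , _ , s) = eventually-all {P = λ θ i → _⊨_ M (bs i) θ} (AllL.map (lower ∘ proj₂) h) []
          in bs i , s
      ; complete   = λ φ ha → Sum.map (λ u → ha , lift u) (λ u → ha , lift u)
          (eventually-split (Sat-neg φ) (Sat-neg⁻¹ φ))
      }

    -- A sequence 𝐛 of length I in which 𝐛 α realises the average type of bs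
    -- over A, bs and all 𝐛 β with β < α.
    module Sequence (A : Pred Carrier ℓ) (A-small : Small M K A)
                    (I : Set ℓ) (I-small : ∣ I ∣ ≺ ∣ K ∣) where

      𝐢 : WellOrdering I
      𝐢 = zermelo I
      open WellOrdering 𝐢 using (_⊏_; ⊏-wellFounded; ⊏-irrefl)
      open Sorting 𝐢

      Base : I → (I → Vec Carrier m) → Pred Carrier ℓ
      Base α b x = A x ⊎ (∃ λ i → ∃ λ j → lookup (bs i) j ≡ x)
                       ⊎ (∃ λ β → β ⊏ α × ∃ λ j → lookup (b β) j ≡ x)

      Base-small : ∀ α b → Small M K (Base α b)
      Base-small α b = ≼-≺-trans (covered-≼ element cover)
        (⊎-small (≼-≺-trans Sub≼⟪⟫ A-small) (×-small (⊎-small ℕ-small I-small) Fin-small))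
        where
        element : Sub A ⊎ ((Lift ℓ ℕ ⊎ I) × Lift ℓ (Fin m)) → Carrier
        element (inj₁ (x , _))               = x
        element (inj₂ (inj₁ (lift i) , lift j)) = lookup (bs i) j
        element (inj₂ (inj₂ β , lift j))        = lookup (b β) j

        cover : ∀ {x} → Base α b x → ∃ λ y → element y ≡ x
        cover (inj₁ h)                     = inj₁ (_ , ⟦⟧-true h) , refl
        cover (inj₂ (inj₁ (i , j , e)))     = inj₂ (inj₁ (lift i) , lift j) , e
        cover (inj₂ (inj₂ (β , _ , j , e))) = inj₂ (inj₂ β , lift j) , e

      -- The default tuple is harmless, since `Base α` consults only entries before `α`.
      fill : ∀ {α} → (∀ {β} → β ⊏ α → Vec Carrier m) → I → Vec Carrier m
      fill {α} h β with em {P = β ⊏ α}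
      ... | yes β⊏α = h β⊏α
      ... | no  _   = Vec.replicate m point

      private
        realization : ∀ α b → Realized M (formulas (averageType (Base α b) (Base-small α b)))
        realization α b = saturated (averageType (Base α b) (Base-small α b))

        recursion : ∃ λ (b : I → Vec Carrier m) →
                    ∀ α → b α ≡ proj₁ (realization α (fill {α} λ {β} _ → b β))
        recursion = wf-recursion ⊏-wellFounded λ α h → proj₁ (realization α (fill {α} h))

      𝐛 : I → Vec Carrier m
      𝐛 = proj₁ recursion

      fill-𝐛 : ∀ {α β} → β ⊏ α → fill {α} (λ {β} _ → 𝐛 β) β ≡ 𝐛 β
      fill-𝐛 {α} {β} β⊏α with em {P = β ⊏ α}
      ... | yes _  = refl
      ... | no  β⊏̸α = contradiction β⊏α β⊏̸α

      𝐛-realises : ∀ α (θ : PFormula M m) → AllV.All (Base α 𝐛) (params θ) →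
                   Eventually (λ i → _⊨_ M (bs i) θ) → _⊨_ M (𝐛 α) θ
      𝐛-realises α θ hθ u = subst (λ c → _⊨_ M c θ) (sym (proj₂ recursion α))
        (proj₂ (realization α b′) {θ} (AllV.map inBase hθ , lift u))
        where
        b′ = fill {α} λ {β} _ → 𝐛 β
        inBase : ∀ {x} → Base α 𝐛 x → Base α b′ x
        inBase (inj₁ h)                        = inj₁ h
        inBase (inj₂ (inj₁ h))                 = inj₂ (inj₁ h)
        inBase (inj₂ (inj₂ (β , β⊏α , j , e))) =
          inj₂ (inj₂ (β , β⊏α , j , trans (cong (λ c → lookup c j) (fill-𝐛 β⊏α)) e))

      -- Completeness of the average: otherwise `𝐛 α` would also realise the negation.
      𝐛-eventually : ∀ α (θ : PFormula M m) → AllV.All (Base α 𝐛) (params θ) →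
                     _⊨_ M (𝐛 α) θ → Eventually (λ i → _⊨_ M (bs i) θ)
      𝐛-eventually α (φ ⟨ u ⟩) hθ s
        with eventually-split {P = λ i → Sat M φ (bs i ++ u)} (Sat-neg φ) (Sat-neg⁻¹ φ)
      ... | inj₁ h = h
      ... | inj₂ h = contradiction s (Sat-neg⁻¹ φ (𝐛-realises α (neg φ ⟨ u ⟩) hθ h))

      𝐛-sameType : ∀ {b₀} → (∀ i → SameType A (bs i) b₀) → ∀ α → SameType A b₀ (𝐛 α)
      𝐛-sameType {b₀} same α φ {u} hu = mk⇔
        -- Applied to `neg φ`, the direction `down` yields the other one.
        (λ s → choose λ n → Sat-neg⁻¹ φ (down (neg φ) (Sat-neg φ n)) s) (down φ)
        where
        down : ∀ φ → Sat M φ (𝐛 α ++ u) → Sat M φ (b₀ ++ u)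
        down φ s =
          let (i , _ , s′) = eventually-some {P = λ i → Sat M φ (bs i ++ u)}
                (𝐛-eventually α (φ ⟨ u ⟩) (AllV.map inj₁ hu) s) []
          in to (same i φ hu) s′

      module _ (φ : Formula L (n + m)) (k : ℕ)
               (clash : ∀ (s : Fin k → ℕ) → Injective _≡_ _≡_ s →
                  ¬ ∃ λ c → ∀ j → Sat M φ (c ++ bs (s j))) where

        -- The entries of v are moved into bs one by one, the greatest first.
        mixed-clash : ∀ {i j} (v : Vec I i) (w : Vec ℕ j) → i + j ≡ k → Descending v → Unique w →
          ¬ ∃ λ c → AllV.All (λ β → Sat M φ (c ++ 𝐛 β)) v × AllV.All (λ t → Sat M φ (c ++ bs t)) w
        mixed-clash [] w refl _ unique (c , _ , h) =
          clash (lookup w) (Uniqueₚ.lookup-injective unique _ _) (c , AllVₚ.lookup⁺ h)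
        mixed-clash {suc i} {j} (α ∷ v) w i+j≡k (v⊏α AllPairs.∷ descending) unique (c , hα AllV.∷ hv , hw) =
          -- `θ` says of `y` that φ(x, y) is jointly satisfiable with all other instances. Their
          -- parameters lie in the base of `α` as `α` is the greatest entry, so `θ` passes from
          -- `𝐛 α` to some `bs t` with `t` outside `w`.
          let (t , t∉w , s) = witness (c , hα , ⋀-intro (AllVₚ.++⁺ (AllVₚ.map⁺ hv) (AllVₚ.map⁺ hw)))
          in mixed-clash v (t ∷ w) (trans (ℕₚ.+-suc i j) i+j≡k) descending (t∉w AllPairs.∷ unique)
               (regroup (to meets s))
          where
          tuples : Vec (Vec Carrier m) (i + j)
          tuples = Vec.map 𝐛 v ++ Vec.map bs w

          ts : List (Template {L = L} Carrier n)
          ts = List.map (λ y → m , φ , y) (Vec.toList tuples)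

          d = proj₁ (⋀ {n = n} ts)
          ψ = proj₁ (proj₂ (⋀ {n = n} ts))
          u = Vec.map id (proj₂ (proj₂ (⋀ {n = n} ts)))

          θ : PFormula M m
          θ = meet n m d φ ψ ⟨ u ⟩

          meets : ∀ {y} → Sat M (meet n m d φ ψ) (y ++ u) ⇔ ∃ λ c → Sat M φ (c ++ y) × Sat M ψ (c ++ u)
          meets = Sat-meet n m d φ ψ

          ⋀-intro : ∀ {c} → AllV.All (λ y → Sat M φ (c ++ y)) tuples → Sat M ψ (c ++ u)
          ⋀-intro {c} h = from (⊨-⋀ {n = n} id {c} ts) (Allₚ.map⁺ (AllVₚ.toList⁺
            (AllV.map (λ {y} → subst (λ y → Sat M φ (c ++ y)) (sym (Vecₚ.map-id y))) h)))

          ⋀-elim : ∀ {c} → Sat M ψ (c ++ u) → AllV.All (λ y → Sat M φ (c ++ y)) tuples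
          ⋀-elim {c} s = AllV.map (λ {y} → subst (λ y → Sat M φ (c ++ y)) (Vecₚ.map-id y))
            (AllVₚ.toList⁻ (Allₚ.map⁻ (to (⊨-⋀ {n = n} id {c} ts) s)))

          ts-params : AllL.All (λ t → AllV.All (Base α 𝐛) (proj₂ (proj₂ t))) ts
          ts-params = Allₚ.map⁺ (AllVₚ.toList⁺ (AllVₚ.++⁺
            (AllVₚ.map⁺ (AllV.map (λ {β} β⊏α → AllVₚ.lookup⁻ λ j → inj₂ (inj₂ (β , β⊏α , j , refl))) v⊏α))
            (AllVₚ.map⁺ (AllV.universal (λ t → AllVₚ.lookup⁻ λ j → inj₂ (inj₁ (t , j , refl))) w))))

          witness : (∃ λ c → Sat M φ (c ++ 𝐛 α) × Sat M ψ (c ++ u)) →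
                    ∃ λ t → AllV.All (t ≢_) w × Sat M (meet n m d φ ψ) (bs t ++ u)
          witness s = eventually-some {P = λ t → Sat M (meet n m d φ ψ) (bs t ++ u)}
            (𝐛-eventually α θ (AllVₚ.map⁺ (⋀-params {n = n} {ts = ts} ts-params))
              (from meets s)) w

          regroup : ∀ {t} → (∃ λ c → Sat M φ (c ++ bs t) × Sat M ψ (c ++ u)) →
            ∃ λ c → AllV.All (λ β → Sat M φ (c ++ 𝐛 β)) v ×
                    AllV.All (λ t → Sat M φ (c ++ bs t)) (t ∷ w)
          regroup (c , ht , s) = let h = ⋀-elim s in
            c , AllVₚ.map⁻ (AllVₚ.++ˡ⁻ (Vec.map 𝐛 v) h) , ht AllV.∷ AllVₚ.map⁻ (AllVₚ.++ʳ⁻ (Vec.map 𝐛 v) h)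

        𝐛-clash : (s : Fin k → I) → Injective _≡_ _≡_ s → ¬ ∃ λ c → ∀ j → Sat M φ (c ++ 𝐛 (s j))
        𝐛-clash s s-injective (c , h) = mixed-clash (sort (tabulate s)) [] (ℕₚ.+-identityʳ k)
          (sort-descending (Uniqueₚ.tabulate⁺ s-injective)) AllPairs.[]
          (c , sort-All (AllVₚ.tabulate⁺ h) , AllV.[])

  -- Automorphisms and conjugate types.

  private
    to⟨_⟩ : Automorphism M → Carrier → Carrier
    to⟨ f ⟩ = Automorphism.to f

    from⟨_⟩ : Automorphism M → Carrier → Carrier
    from⟨ f ⟩ = Automorphism.from f

  map-to-from : (f : Automorphism M) (u : Vec Carrier m) → Vec.map to⟨ f ⟩ (Vec.map from⟨ f ⟩ u) ≡ u
  map-to-from f u = trans (sym (Vecₚ.map-∘ _ _ u))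
    (trans (Vecₚ.map-cong (Automorphism.strictlyInverseˡ f) u) (Vecₚ.map-id u))

  map-from-to : (f : Automorphism M) (u : Vec Carrier m) → Vec.map from⟨ f ⟩ (Vec.map to⟨ f ⟩ u) ≡ u
  map-from-to f u = trans (sym (Vecₚ.map-∘ _ _ u))
    (trans (Vecₚ.map-cong (Automorphism.strictlyInverseʳ f) u) (Vecₚ.map-id u))

  ⊨-mapParams : (f : Automorphism M) (c : Vec Carrier n) (θ : PFormula M n) →
                _⊨_ M (Vec.map from⟨ f ⟩ c) θ ⇔ _⊨_ M c (mapParams M to⟨ f ⟩ θ)
  ⊨-mapParams f c (φ ⟨ u ⟩) = subst (λ v → Sat M φ (Vec.map from⟨ f ⟩ c ++ u) ⇔ Sat M φ v)
    (trans (Vecₚ.map-++ _ (Vec.map from⟨ f ⟩ c) u) (cong (_++ Vec.map to⟨ f ⟩ u) (map-to-from f c)))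
    (Sat-aut f φ (Vec.map from⟨ f ⟩ c ++ u))

  conj-⊢ : (f : Automorphism M) (q : Type n) {θ : PFormula M n} → formulas q ⊢ θ →
           formulas (conj f q) ⊢ mapParams M to⟨ f ⟩ θ
  conj-⊢ f q {θ} (Δ , hΔ , entails) = List.map (mapParams M to⟨ f ⟩) Δ
    , Allₚ.map⁺ (AllL.map (λ { {φ ⟨ u ⟩} → subst (λ u → formulas q (φ ⟨ u ⟩)) (sym (map-from-to f u)) }) hΔ)
    , λ c s → to (⊨-mapParams f c θ) (entails _
        (AllL.map (λ {θ} → from (⊨-mapParams f c θ)) (Allₚ.map⁻ s)))

  conj-extends : (f : Automorphism M) (p : Type n) {q : Type n} → p ⊑ q →
                 (∀ {x} → dom p x → to⟨ f ⟩ x ≡ x) → p ⊑ conj f q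
  conj-extends f p {q} p⊑q fixes {φ ⟨ u ⟩} h =
    subst (λ u → formulas q (φ ⟨ u ⟩)) (sym (fixed (over p h))) (p⊑q h)
    where
    fixed : ∀ {m} {u : Vec Carrier m} → AllV.All (dom p) u → Vec.map from⟨ f ⟩ u ≡ u
    fixed AllV.[]       = refl
    fixed (h AllV.∷ hs) = cong₂ _∷_
      (trans (cong from⟨ f ⟩ (sym (fixes h))) (Automorphism.strictlyInverseʳ f _)) (fixed hs)

  dom-conj : (f : Automorphism M) (q : Type n) → ⟪ dom (conj f q) ⟫ ≼ ∣ Sub (dom q) ∣
  dom-conj f q = covered-≼ (λ (x , _) → to⟨ f ⟩ x) λ {x} h →
    (from⟨ f ⟩ x , ⟦⟧-true h) , Automorphism.strictlyInverseˡ f x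

  consistent-⊢ : {Γ : Pred (PFormula M n) ℓ} → Consistent M Γ → ∀ {k} {θ : Fin k → PFormula M n} →
                 (∀ i → Γ ⊢ θ i) → ∃ λ c → ∀ i → _⊨_ M c (θ i)
  consistent-⊢ {Γ = Γ} consistent {k} h =
    let (c , s) = consistent (List.concat Δs) (Allₚ.concat⁺ (Allₚ.tabulate⁺ (proj₁ ∘ proj₂ ∘ h)))
    in c , λ i → proj₂ (proj₂ (h i)) c (Allₚ.tabulate⁻ (Allₚ.concat⁻ {xss = Δs} s) i)
    where
    Δs = List.tabulate (proj₁ ∘ h)

  -- Homogeneity is applied to an enumeration of `A` together with the tuple; `separate` brings
  -- mixed tuples into the form that `same` speaks of.
  sameType⇒automorphism : (A : Pred Carrier ℓ) → Small M K A → (b b′ : Vec Carrier m) →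
    SameType A b b′ → ∃ λ f → (∀ {x} → A x → to⟨ f ⟩ x ≡ x) × Vec.map to⟨ f ⟩ b ≡ b′
  sameType⇒automorphism {m} A A-small b b′ same =
    let (f , hf) = homogeneous (Sub A ⊎ Fin m) J-small (env b) (env b′) elementary
    in f , (λ {x} h → hf (inj₁ (x , ⟦⟧-true h)))
         , image f λ j → hf (inj₂ j)
    where
    image : ∀ {m} {b b′ : Vec Carrier m} f → (∀ j → to⟨ f ⟩ (lookup b j) ≡ lookup b′ j) →
            Vec.map to⟨ f ⟩ b ≡ b′
    image {b = []}    {[]}    f h = refl
    image {b = _ ∷ _} {_ ∷ _} f h = cong₂ _∷_ (h zero) (image f (h ∘ suc))

    env : Vec Carrier m → Sub A ⊎ Fin m → Carrier
    env b = [ proj₁ , lookup b ]′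

    J-small : ∣ Sub A ⊎ Fin m ∣ ≺ ∣ K ∣
    J-small = ≼-≺-trans (mk↣ {to = Sum.map₂ lift} injective)
      (⊎-small (≼-≺-trans Sub≼⟪⟫ A-small) Fin-small)
      where
      injective : Injective _≡_ _≡_ (Sum.map₂ (lift {ℓ = ℓ}))
      injective {inj₁ _} {inj₁ _} refl = refl
      injective {inj₂ _} {inj₂ _} refl = refl

    elementary : ∀ {l} (φ : Formula L l) (i : Vec (Sub A ⊎ Fin m) l) →
                 Sat M φ (Vec.map (env b) i) ⇔ Sat M φ (Vec.map (env b′) i)
    elementary φ i = mk⇔
      (λ s → to (over-A b′) (to middle (from (over-A b) s)))
      (λ s → to (over-A b) (from middle (from (over-A b′) s)))
      where
      separated = separate i
      u = proj₁ (proj₂ separated)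
      σ = proj₁ (proj₂ (proj₂ separated))

      over-A : ∀ b → Sat M (ren σ φ) (b ++ Vec.map proj₁ u) ⇔ Sat M φ (Vec.map (env b) i)
      over-A b = Sat-ren σ φ λ j →
        trans (proj₂ (proj₂ (proj₂ separated)) proj₁ b j) (sym (Vecₚ.lookup-map j (env b) i))

      middle = same (ren σ φ) {Vec.map proj₁ u}
        (AllVₚ.map⁺ (AllV.universal (λ (_ , h) → ⟦⟧-true⁻¹ h) u))

  module _ {𝔄 : TypeClass a} (R : Rank 𝔄 o) where
    open TypeClass 𝔄
    open Rank R

    -- From dividing ranks to weak bounded multiplicity.

    module Bounded (dividing : DividingRank R) {n} (p : Type n) (hp : Member p) (ranked : Ranked p hp)
                   (k : ℕ) {Λ : Set ℓ} (Λ≺K : ∣ Λ ∣ ≺ ∣ K ∣) where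

      A : Set ℓ
      A = Sub (dom p)

      -- What the indices of the parameters of a type remember of it: the
      -- type over dom p of all parameters, and the formulas in the type.
      Shape : Set ℓ
      Shape = (Template {L = L} (Λ ⊎ A) 0 → Bool) × (Template {L = L} Λ n → Bool)

      Colour : Set ℓ
      Colour = List (Template {L = L} Λ n)

      -- The first factor lets `pigeonhole` fix a shape; the second leaves enough types of that
      -- shape for `erdős-rado`.
      bound : Set ℓ
      bound = Shape × ErdősRadoBound Colour k

      bound≺K : ∣ bound ∣ ≺ ∣ K ∣
      bound≺K = ×-small
        (×-small (strongLimit _ (Template-small (⊎-small Λ≺K (Sub-dom-small p))))
                 (strongLimit _ (Template-small Λ≺K)))
        (er k)
        where
        er : ∀ k → ∣ ErdősRadoBound Colour k ∣ ≺ ∣ K ∣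
        er zero    = ℕ-small
        er (suc k) = ×-small (strongLimit _ (er k)) (×-small (→-small (er k) (strongLimit _ (er k)))
          (→-small (Vec-small (er k)) (strongLimit _ (List-small (Template-small Λ≺K)))))

      module _ (Q : Pred (Type n) (lsuc ℓ)) (inconsistent : k -Inconsistent Q)
               (Q-spec : ∀ q → Q q → Σ (p ⊑ q) λ p⊑q →
                  ⟪ dom q ⟫ ≼ ∣ Λ ∣ × rank q (extension hp p⊑q) ≈∞ rank p hp) where

        -- The collection is brought down to `Set ℓ`, the level of the bounds, by passing to codes.
        X : Set ℓ
        X = Sub {X = PFormula M n → Bool} λ s → ∃ λ q → Q q × code q ≡ s

        typeOf : X → Type n
        typeOf (_ , h) = proj₁ (⟦⟧-true⁻¹ h)

        typeOf∈Q : ∀ x → Q (typeOf x)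
        typeOf∈Q (_ , h) = proj₁ (proj₂ (⟦⟧-true⁻¹ h))

        code-typeOf : ∀ x → code (typeOf x) ≡ proj₁ x
        code-typeOf (_ , h) = proj₂ (proj₂ (⟦⟧-true⁻¹ h))

        typeOf-injective : ∀ {x y} → typeOf x ≋ typeOf y → x ≡ y
        typeOf-injective {x} {y} e =
          Sub-≡ (trans (sym (code-typeOf x)) (trans (≋⇒code (typeOf x) (typeOf y) e) (code-typeOf y)))

        Q≼X : typeSetoid n ↾ Q ≼ ∣ X ∣
        Q≼X = record
          { to        = λ (q , h) → code q , ⟦⟧-true (q , h , refl)
          ; cong      = λ {(q , _)} {(r , _)} e → Sub-≡ (≋⇒code q r e)
          ; injective = λ {(q , _)} {(r , _)} e → code⇒≋ q r (cong proj₁ e)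
          }

        p⊑ : ∀ x → p ⊑ typeOf x
        p⊑ x = proj₁ (Q-spec (typeOf x) (typeOf∈Q x))

        label : ∀ x → ⟪ dom (typeOf x) ⟫ ≼ ∣ Λ ∣
        label x = proj₁ (proj₂ (Q-spec (typeOf x) (typeOf∈Q x)))

        rank-typeOf : ∀ x → rank (typeOf x) (extension hp (p⊑ x)) ≈∞ rank p hp
        rank-typeOf x = proj₂ (proj₂ (Q-spec (typeOf x) (typeOf∈Q x)))

        -- An inverse of `label x`. Indices that label nothing receive `point`; `param-cover` still
        -- reaches the whole domain.
        param : X → Λ → Carrier
        param x i with em {P = ∃ λ d → Injection.to (label x) d ≡ i}
        ... | yes ((y , _) , _) = y
        ... | no  _             = point

        param-cover : ∀ x {y} → dom (typeOf x) y → ∃ λ i → param x i ≡ y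
        param-cover x {y} d = i , eq
          where
          i = Injection.to (label x) (y , d)
          eq : param x i ≡ y
          eq with em {P = ∃ λ d → Injection.to (label x) d ≡ i}
          ... | yes (_ , e) = Injection.injective (label x) e
          ... | no  none    = contradiction ((y , d) , refl) none

        param⁺ : X → Λ ⊎ A → Carrier
        param⁺ x = [ param x , proj₁ ]′

        shape : X → Shape
        shape x = (λ t → ⟦ _⊨_ M [] (inst (param⁺ x) t) ⟧)
                , (λ t → ⟦ formulas (typeOf x) (inst (param x) t) ⟧)

        sameType : ∀ {x y} → shape x ≡ shape y → (u : Vec Λ m) →
                   SameType (dom p) (Vec.map (param x) u) (Vec.map (param y) u)
        sameType {m = m} {x} {y} e u {l} φ {c} hc = mk⇔ (half {x} {y} e) (half {y} {x} (sym e))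
          where
          cover = map-cover {A = dom p} (proj₁ {B = λ z → ⟦ dom p z ⟧ ≡ true})
                    (λ {z} h → (z , ⟦⟧-true h) , refl) hc
          w = proj₁ cover

          t : Template {L = L} (Λ ⊎ A) 0
          t = m + l , φ , Vec.map inj₁ u ++ Vec.map inj₂ w

          env : ∀ x → Vec.map (param⁺ x) (Vec.map inj₁ u ++ Vec.map inj₂ w) ≡ Vec.map (param x) u ++ c
          env x = trans (Vecₚ.map-++ (param⁺ x) (Vec.map inj₁ u) (Vec.map inj₂ w))
            (cong₂ _++_ (sym (Vecₚ.map-∘ (param⁺ x) inj₁ u))
              (trans (sym (Vecₚ.map-∘ (param⁺ x) inj₂ w)) (proj₂ cover)))

          half : ∀ {x y} → shape x ≡ shape y → Sat M φ (Vec.map (param x) u ++ c) →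
                 Sat M φ (Vec.map (param y) u ++ c)
          half {x} {y} e s = subst (Sat M φ) (env y)
            (⟦⟧-cong⁻¹ (cong-app (cong proj₁ e) t) (subst (Sat M φ) (sym (env x)) s))

        OfShape : Shape → Colour → Set ℓ
        OfShape σ = AllL.All λ t → Lift ℓ (proj₂ σ t ≡ true)

        Clashing : ∀ {j} → Vec X j → Colour → Set ℓ
        Clashing v δ = ¬ ∃ λ c → AllV.All (λ x → AllL.All (λ t → _⊨_ M c (inst (param x) t)) δ) v

        -- An unsatisfiable finite part of the union of the types is renamed into templates. As the
        -- shape is shared, each template belongs to all the types, and instantiating every template
        -- at every entry only adds formulas.
        clash : ∀ σ (v : Vec X k) → Unique v → AllV.All (λ x → shape x ≡ σ) v →
                ∃ λ δ → OfShape σ δ × Clashing v δ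
        clash σ v unique shapes = choose λ none →
          inconsistent (typeOf ∘ lookup v) (typeOf∈Q ∘ lookup v)
            (λ {i} {j} e → Uniqueₚ.lookup-injective unique i j (typeOf-injective e))
            λ Δ hΔ → let (δ , of-shape , implies) = translate hΔ in
              choose λ unsat → none (δ , of-shape , λ (c , h) → unsat (c , implies c h))
          where
          translate : ∀ {Δ} → AllL.All (λ θ → ∃ λ i → formulas (typeOf (lookup v i)) θ) Δ →
            ∃ λ δ → OfShape σ δ × (∀ c →
              AllV.All (λ x → AllL.All (λ t → _⊨_ M c (inst (param x) t)) δ) v → AllL.All (_⊨_ M c) Δ)
          translate [] = [] , [] , λ _ _ → []
          translate {θ@(φ ⟨ _ ⟩) ∷ _} ((i , hθ) ∷ hs) =
            let x = lookup v i
                (δ , of-shape , implies) = translate hs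
                (u , e) = map-cover (param x) (param-cover x) (over (typeOf x) hθ)
                t = _ , φ , u
                in-shape = subst (λ σ → proj₂ σ t ≡ true) (AllVₚ.lookup⁺ shapes i)
                  (⟦⟧-true (subst (λ u → formulas (typeOf x) (φ ⟨ u ⟩)) (sym e) hθ))
            in t ∷ δ , lift in-shape ∷ of-shape , λ c h →
                 subst (λ u → Sat M φ (c ++ u)) e (AllL.head (AllVₚ.lookup⁺ h i)) ∷
                 implies c (AllV.map AllL.tail h)

        colour : Shape → Vec X k → Colour
        colour σ v with em {P = ∃ λ δ → OfShape σ δ × Clashing v δ}
        ... | yes (δ , _) = δ
        -- This default never occurs for distinct entries of shape `σ`, by `clash`.
        ... | no  _       = []

        colour-clash : ∀ σ v → Unique v → AllV.All (λ x → shape x ≡ σ) v →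
                       OfShape σ (colour σ v) × Clashing v (colour σ v)
        colour-clash σ v unique shapes with em {P = ∃ λ δ → OfShape σ δ × Clashing v δ}
        ... | yes (_ , h) = h
        ... | no  none    = contradiction (clash σ v unique shapes) none

        𝐱 : WellOrdering X
        𝐱 = zermelo X
        open WellOrdering 𝐱 using (_⊏_; ⊏-irrefl)
        open Sorting 𝐱

        module _ {σ : Shape} {h : ℕ → X} {δ : Colour} (h-injective : Injective _≡_ _≡_ h)
                 {H : Pred X ℓ} (h∈H : ∀ i → H (h i)) (H-shape : ∀ {x} → H x → shape x ≡ σ)
                 (homogeneous : ∀ {v} → Descending v → AllV.All H v → colour σ v ≡ δ) where

          -- Homogeneity concerns descending tuples, so the tuple is sorted first; joint
          -- satisfaction does not depend on the order.
          H-clash : (s : Fin k → ℕ) → Injective _≡_ _≡_ s →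
                    OfShape σ δ × Clashing (tabulate (h ∘ s)) δ
          H-clash s s-injective =
            let (of-shape , clashing) = colour-clash σ v
                  (AllPairs.map (λ { y⊏x refl → ⊏-irrefl y⊏x }) descending)
                  (AllV.map H-shape v∈H)
                eq = homogeneous descending v∈H
            in subst (OfShape σ) eq of-shape
             , λ (c , sat) → subst (Clashing v) eq clashing (c , sort-All sat)
            where
            v = sort (tabulate (h ∘ s))
            descending = sort-descending (Uniqueₚ.tabulate⁺ (s-injective ∘ h-injective))
            v∈H = sort-All {P = H} (AllVₚ.tabulate⁺ (h∈H ∘ s))

          divides : typeOf (h 0) Divides dom p
          divides = inst (param (h 0)) (⋀ δ)
            , (List.map (inst (param (h 0))) δ
              , Allₚ.map⁺ (AllL.map (λ {t} e → ⟦⟧-true⁻¹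
                  (trans (cong (λ σ → proj₂ σ t) (H-shape (h∈H 0))) (lower e)))
                  -- Any `k` distinct indices show that `δ` fits the shape; the first `k` are taken.
                  (proj₁ (H-clash toℕ toℕ-injective)))
              , λ c sat → from (⊨-⋀ (param (h 0)) δ) (Allₚ.map⁻ sat))
            -- The names of the conjunction are read at each `h i`; equal shapes give equal types
            -- over `dom p`.
            , k , (λ i → Vec.map (param (h i)) (proj₂ (proj₂ (⋀ δ))))
            , (λ i → sameType {x = h i} {h 0} (trans (H-shape (h∈H i)) (sym (H-shape (h∈H 0))))
                       (proj₂ (proj₂ (⋀ δ))))
            , λ s s-injective (c , sat) → proj₂ (H-clash s s-injective)
                (c , AllVₚ.tabulate⁺ λ j → to (⊨-⋀ (param (h (s j))) δ) (sat j))

        Q≼bound : typeSetoid n ↾ Q ≼ ∣ bound ∣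
        Q≼bound = choose λ large →
          let (σ , large-σ) = pigeonhole shape (λ i → large (≼-trans Q≼X i))
              (H , H-shape , H-large , δ , homogeneous) =
                erdős-rado 𝐱 k (colour σ) (λ x → shape x ≡ σ) large-σ
              (h , h-injective , h∈H) = infinite H-large
          in ≈∞⇒≮∞ (rank-typeOf (h 0)) (dividing p (typeOf (h 0)) hp _ (p⊑ (h 0)) ranked
               (divides h-injective h∈H H-shape homogeneous))

    dividing⇒bounded : DividingRank R → WeakBoundedMultiplicity R
    dividing⇒bounded dividing p hp ranked k _ Λ Λ≺K = bound , bound≺K , Q≼bound
      where open Bounded dividing p hp ranked k Λ≺K

    -- From weak bounded multiplicity to dividing ranks.

    rank-conj : {p q : Type n} (hp : Member p) (hq : Member q) → rank q hq ≈∞ rank p hp →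
                ∀ f (p⊑ : p ⊑ conj f q) → rank (conj f q) (extension hp p⊑) ≈∞ rank p hp
    -- The conjugate is a member both by `conjugate` and by `extension`; heredity along the identity
    -- reconciles the two ranks.
    rank-conj hp hq eq f p⊑ = ≈∞-trans
      (≤∞-antisym (heredity (conjugate hq f) (extension hp p⊑) id)
                  (heredity (extension hp p⊑) (conjugate hq f) id))
      (≈∞-trans (≈∞-sym (isomorphism hq f)) eq)

    module Conjugates (wbm : WeakBoundedMultiplicity R) {n} (p q : Type n)
                      (hp : Member p) (hq : Member q) (p⊑q : p ⊑ q) (ranked : Ranked p hp)
                      (rank-eq : rank q hq ≈∞ rank p hp)
                      {m} (φ : Formula L (n + m)) (b₀ : Vec Carrier m) (q⊢ : formulas q ⊢ (φ ⟨ b₀ ⟩))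
                      (k : ℕ) (bs : ℕ → Vec Carrier m) (same : ∀ i → SameType (dom p) (bs i) b₀)
                      (2≤k : 2 ℕ.≤ k)
                      (clash : ∀ (s : Fin k → ℕ) → Injective _≡_ _≡_ s →
                         ¬ ∃ λ c → ∀ j → Sat M φ (c ++ bs (s j))) where

      bounded : ∃ λ (κ : Set ℓ) → ∣ κ ∣ ≺ ∣ K ∣ × (∀ (Q : Pred (Type n) (lsuc ℓ)) → k -Inconsistent Q →
        (∀ q′ → Q q′ → Σ (p ⊑ q′) λ p⊑q′ →
          ⟪ dom q′ ⟫ ≼ ∣ Sub (dom q) ∣ × rank q′ (extension hp p⊑q′) ≈∞ rank p hp) →
        typeSetoid n ↾ Q ≼ ∣ κ ∣)
      -- The automorphisms carry `dom q` onto the domains of the conjugates, so `dom q` itself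
      -- bounds their sizes.
      bounded = wbm p hp ranked k 2≤k (Sub (dom q)) (Sub-dom-small q)

      κ : Set ℓ
      κ = proj₁ bounded

      -- By diagonalisation no map I → κ has all its fibres of size less
      -- than k.
      I : Set ℓ
      I = κ → Lift ℓ (Fin k)

      open Sequence bs (dom p) (small p) I (→-small (proj₁ (proj₂ bounded)) Fin-small)

      moving : ∀ α → ∃ λ f → (∀ {x} → dom p x → to⟨ f ⟩ x ≡ x) × Vec.map to⟨ f ⟩ b₀ ≡ 𝐛 α
      moving α = sameType⇒automorphism (dom p) (small p) b₀ (𝐛 α) (𝐛-sameType same α)

      conjugateAt : I → Type n
      conjugateAt α = conj (proj₁ (moving α)) q

      conjugateAt-⊢ : ∀ α → formulas (conjugateAt α) ⊢ (φ ⟨ 𝐛 α ⟩)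
      conjugateAt-⊢ α = subst (λ b → formulas (conjugateAt α) ⊢ (φ ⟨ b ⟩))
        (proj₂ (proj₂ (moving α))) (conj-⊢ (proj₁ (moving α)) q {φ ⟨ b₀ ⟩} q⊢)

      p⊑conjugateAt : ∀ α → p ⊑ conjugateAt α
      p⊑conjugateAt α = conj-extends (proj₁ (moving α)) p {q} p⊑q (proj₁ (proj₂ (moving α)))

      -- `Γ` proves `k` distinct instances of `φ`. It is left arbitrary to serve twice: for a union
      -- of conjugates, and in `missed` for a single conjugate.
      inconsistent : {Γ : Pred (PFormula M n) ℓ} (s : Fin k → I) → Injective _≡_ _≡_ s →
                     (∀ j {θ} → formulas (conjugateAt (s j)) θ → Γ θ) → ¬ Consistent M Γ
      inconsistent {Γ} s s-injective sub consistent = 𝐛-clash φ k clash s s-injective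
        (consistent-⊢ consistent {θ = λ j → φ ⟨ 𝐛 (s j) ⟩} λ j →
          let (Δ , hΔ , entails) = conjugateAt-⊢ (s j) in Δ , AllL.map (sub j) hΔ , entails)

      Q : Pred (Type n) (lsuc ℓ)
      Q r = ∃ λ α → conjugateAt α ≡ r

      Q-inconsistent : k -Inconsistent Q
      Q-inconsistent r r∈Q r-injective = inconsistent (proj₁ ∘ r∈Q)
        (λ {i} {j} e → r-injective {i} {j} (subst₂ _≋_ (proj₂ (r∈Q i)) (proj₂ (r∈Q j))
          (subst (λ α → conjugateAt (proj₁ (r∈Q i)) ≋ conjugateAt α) e (id , id))))
        λ j {θ} h → j , subst (λ r → formulas r θ) (proj₂ (r∈Q j)) h

      Q-spec : ∀ r → Q r → Σ (p ⊑ r) λ p⊑r →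
               ⟪ dom r ⟫ ≼ ∣ Sub (dom q) ∣ × rank r (extension hp p⊑r) ≈∞ rank p hp
      Q-spec _ (α , refl) = p⊑conjugateAt α , dom-conj (proj₁ (moving α)) q
        , rank-conj hp hq rank-eq (proj₁ (moving α)) (p⊑conjugateAt α)

      Q≼κ : typeSetoid n ↾ Q ≼ ∣ κ ∣
      Q≼κ = proj₂ (proj₂ bounded) Q Q-inconsistent Q-spec

      colour : I → κ
      colour α = Injection.to Q≼κ (conjugateAt α , α , refl)

      colour⇒≋ : ∀ {α β} → colour α ≡ colour β → conjugateAt α ≋ conjugateAt β
      colour⇒≋ = Injection.injective Q≼κ

      -- If every value were hit, the `k` indices hitting them would be distinct but of one colour.
      -- Their conjugates would then coincide, and one consistent type would contain them all,
      -- against `inconsistent`.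
      missed : ∀ x → ∃ λ (j : Fin k) → ∀ α → colour α ≡ x → α x ≢ lift j
      missed x = choose λ none →
        let hit : ∀ j → ∃ λ α → colour α ≡ x × α x ≡ lift j
            hit j = choose λ no → none (j , λ α e e′ → no (α , e , e′))
            injective : Injective _≡_ _≡_ (proj₁ ∘ hit)
            injective {i} {j} e = cong lower (trans (sym (proj₂ (proj₂ (hit i))))
              (trans (cong (λ α → α x) e) (proj₂ (proj₂ (hit j)))))
            first = Fin.fromℕ< (ℕₚ.≤-trans (s≤s z≤n) 2≤k)
        in inconsistent (proj₁ ∘ hit) injective
             (λ j → proj₁ (colour⇒≋ (trans (proj₁ (proj₂ (hit j))) (sym (proj₁ (proj₂ (hit first)))))))
             (consistent (conjugateAt (proj₁ (hit first))))

      diagonal : I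
      diagonal x = lift (proj₁ (missed x))

      -- At its own colour, `diagonal` takes the very value that indices of this colour miss.
      absurd : ∀ {w} {Whatever : Set w} → Whatever
      absurd = contradiction refl (proj₂ (missed (colour diagonal)) diagonal refl)

    bounded⇒dividing : WeakBoundedMultiplicity R → DividingRank R
    bounded⇒dividing wbm p q hp hq p⊑q ranked (φ ⟨ b₀ ⟩ , q⊢ , k , bs , same , clash) =
      choose λ ≮ → Conjugates.absurd wbm p q hp hq p⊑q ranked
        -- Dividing may be witnessed by `k` below 2, whereas the multiplicity condition asks for at
        -- least 2. With `2 + k` instances, dropping two leaves `k` distinct ones.
        (≮∞⇒≈∞ (heredity hp hq p⊑q) ≮) φ b₀ q⊢ (2 + k) bs same (s≤s (s≤s z≤n))
        λ s s-injective (c , h) → clash (λ j → s (suc (suc j)))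
          (λ e → Fin-suc (s-injective e)) (c , λ j → h (suc (suc j)))
      where
      Fin-suc : ∀ {k} {i j : Fin k} → Fin.suc (Fin.suc i) ≡ suc (suc j) → i ≡ j
      Fin-suc refl = refl

proposition2p15 : (∀ {a} → ExcludedMiddle a) →
    (∀ {a b} → Extensionality a b) →
    ∀ {ℓ a o} {L : Language ℓ} (T : Theory L) → CompleteTheory T →
    (K : Set ℓ) → SufficientlyLarge L K →
    (𝕮 : MonsterModel T K) →
    let open Ranks 𝕮 in
    (𝔄 : TypeClass a) (R : Rank 𝔄 o) →
    DividingRank R ⇔ WeakBoundedMultiplicity R
proposition2p15 em ext T _ K K-large 𝕮 𝔄 R =
  mk⇔ (dividing⇒bounded R) (bounded⇒dividing R)
  where open Monster em ext K-large 𝕮
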